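{- Let $r,p,s,n$ be positive integers such that $p\mid r$, $s\mid r$ and $ps\mid rn$. Then, as formal power series in $t,q$, $$\Bigg\{\sum_{k\geq0}t^k\Big[\frac{r}{s}k+1\Big]_q^n\Bigg\}_{q^p}=\frac{\sum_{g\in G(r,p,s,n)}t^{\mathrm{des}(g)}q^{\mathrm{fmaj}(g)}}{(1-t)(1-t^sq^r)(1-t^sq^{2r})\cdots(1-t^sq^{(n-1)r})(1-tq^{nr/s})}.$$
   Context: Notation. For a positive integer $m$, $R_m(i)\in\{0,\ldots,m-1\}$ denotes the residue of $i\in\mathbb Z$ modulo $m$. $[m]_x=1+x+\cdots+x^{m-1}$. For a power series $F$, $\{F\}_{q^p}$ is obtained from $F$ by discarding all terms whose degree in $q$ is not divisible by $p$. Groups. $G(r,n)$ is the group of pairs $(c_1,\ldots,c_n;\sigma)$ with $c_i\in\{0,\ldots,r-1\}$ (the colors) and $\sigma\in S_n$, with product $(d_1,\ldots,d_n;\tau)(c_1,\ldots,c_n;\sigma)=(R_r(c_1+d_{\sigma(1)}),\ldots,R_r(c_n+d_{\sigma(n)});\tau\sigma)$. For $p\mid r$, $G(r,p,n)$ is the subgroup of elements with $c_1+\cdots+c_n\equiv 0 \bmod p$. For $s\mid r$ with $ps\mid rn$, $C_s\subseteq G(r,p,n)$ is the cyclic subgroup of order $s$ generated by $(r/s,\ldots,r/s;\mathrm{id})$, and $G(r,p,s,n)=G(r,p,n)/C_s$. Statistics. For $g\in G(r,p,s,n)$ represented by $(c_1,\ldots,c_n;\sigma)$ let $\mathrm{HDes}(g)=\{i\in\{1,\ldots,n-1\}: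 c_i=c_{i+1},\ \sigma(i)>\sigma(i+1)\}$, $h_i(g)=\#\{j\ge i: j\in\mathrm{HDes}(g)\}$, $k_n(g)=R_{r/s}(c_n)$, $k_i(g)=k_{i+1}(g)+R_r(c_i-c_{i+1})$ for $1\le i\le n-1$, $\lambda_i(g)=r\,h_i(g)+k_i(g)$. Then $\mathrm{fmaj}(g)=\sum_{i=1}^n\lambda_i(g)$ and $\mathrm{des}(g)=\left\lfloor\frac{s\lambda_1(g)+r-s}{r}\right\rfloor$. These do not depend on the representative chosen. -}

module Defs where

open import Algebra.Bundles using (Group; RawSemiring)
import Algebra.Definitions.RawSemiring as RawSemiringDefinitions
import Algebra.Properties.CommutativeMonoid.Sum as CommutativeMonoidSum
import Algebra.Properties.Monoid.Mult as MonoidMult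
open import Data.Fin.Base using (Fin; zero; suc; toℕ; fromℕ<)
import Data.Fin.Base as Fin
import Data.Fin.Properties as Fin
open import Data.Fin.Permutation as Perm using (Permutation′; _⟨$⟩ʳ_; _⟨$⟩ˡ_; _∘ₚ_)
open import Data.Integer.Base as ℤ using (ℤ; 0ℤ; 1ℤ)
open import Data.Integer.DivMod using (_%ℕ_)
import Data.Integer.Properties as ℤ
open import Data.List.Base using (List; []; _∷_; length; filter; allFin; foldr; cartesianProductWith; deduplicate)
open import Data.List.Membership.Propositional.Properties using (∈-allFin)
open import Data.List.Membership.Setoid.Properties using (∈-cartesianProductWith⁺)
open import Data.List.Relation.Unary.Any as Any using (here; there)
import Data.List.Relation.Unary.Enumerates.Setoid as Enumerates
import Data.List.Relation.Unary.Enumerates.Setoid.Properties as Enumerates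
import Data.List.Relation.Unary.Unique.DecSetoid.Properties as Unique
import Data.List.Relation.Unary.Unique.Setoid as Unique
open import Data.Nat.Base using (ℕ; zero; suc; _+_; _*_; _∸_; pred; NonZero; >-nonZero; >-nonZero⁻¹)
open import Data.Nat.DivMod
open import Data.Nat.Divisibility using (_∣_; _∣?_; ∣⇒≤)
import Data.Nat.Properties as ℕ
open import Data.Product.Base using (_×_; _,_; Σ-syntax; ∃-syntax; proj₁)
import Data.Vec.Functional as Vector
open import Function.Base using (_∘_)
open import Level using (0ℓ)
open import Relation.Binary.Bundles using (Setoid; DecSetoid)
open import Relation.Binary.PropositionalEquality as ≡
open import Relation.Nullary using (Dec; yes; no; contradiction; ⌊_⌋)
open import Relation.Nullary.Decidable using (map′; _×-dec_)
open import Data.Bool.Base using (if_then_else_; _∧_)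

-- F i j is the coefficient of tⁱqʲ.
PowerSeries : Set
PowerSeries = ℕ → ℕ → ℤ

open CommutativeMonoidSum ℤ.+-0-commutativeMonoid using () renaming (sum to sumℤ)
open CommutativeMonoidSum ℕ.+-0-commutativeMonoid using (sum-cong-≗) renaming (sum to sumℕ)

t^_q^_ : ℕ → ℕ → PowerSeries
(t^ a q^ b) i j = if ⌊ i ℕ.≟ a ⌋ ∧ ⌊ j ℕ.≟ b ⌋ then 1ℤ else 0ℤ

powerSeriesRawSemiring : RawSemiring 0ℓ 0ℓ
powerSeriesRawSemiring = record
  { Carrier = PowerSeries
  ; _≈_     = λ F G → ∀ i j → F i j ≡ G i j
  ; _+_     = λ F G i j → F i j ℤ.+ G i j
  ; _*_     = λ F G i j →
      sumℤ {suc i} λ a → sumℤ {suc j} λ b →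
        F (toℕ a) (toℕ b) ℤ.* G (i ∸ toℕ a) (j ∸ toℕ b)
  ; 0#      = λ _ _ → 0ℤ
  ; 1#      = t^ 0 q^ 0
  }

open RawSemiring powerSeriesRawSemiring public
  using (0#; 1#)
  renaming (_≈_ to _≋_; _+_ to _⊕_; _*_ to _⊛_)
open RawSemiringDefinitions powerSeriesRawSemiring public
  using ()
  renaming (sum to ∑; product to ∏; _^_ to _↑_)

infixl 6 _⊖_
_⊖_ : PowerSeries → PowerSeries → PowerSeries
(F ⊖ G) i j = F i j ℤ.- G i j

-- Equality with the fraction N / D in the ring of power series:
-- D is invertible and F = N · D⁻¹.
infix 4 _≋_÷_
_≋_÷_ : PowerSeries → PowerSeries → PowerSeries → Set
F ≋ N ÷ D = ∃[ D⁻¹ ] D ⊛ D⁻¹ ≋ 1# × F ≋ N ⊛ D⁻¹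

-- The infinite sum ∑_{k ≥ 0} tᵏ Fₖ; only the terms with k ≤ i contribute
-- to the coefficient of tⁱ.
∑t^ : (ℕ → PowerSeries) → PowerSeries
∑t^ F i j = sumℤ {suc i} λ k → F (toℕ k) (i ∸ toℕ k) j

[_]q : ℕ → PowerSeries
[ m ]q = ∑ {m} λ a → t^ 0 q^ toℕ a

⟦_⟧q^_ : PowerSeries → ℕ → PowerSeries
(⟦ F ⟧q^ p) i j = if ⌊ p ∣? j ⌋ then F i j else 0ℤ

module CyclicCosets {c ℓ} (G : Group c ℓ) (z : Group.Carrier G) where

  open Group G renaming (refl to ≈-refl; sym to ≈-sym; trans to ≈-trans; setoid to ≈-setoid)
  open MonoidMult monoid using (×-homo-+; ×-assocˡ; ×-congʳ; ×-congˡ) renaming (_×_ to _·_)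

  -- x and y lie in the same coset of the cyclic subgroup generated by z, when
  -- z has finite order: k · z is the k-th power of z.
  infix 4 _∼_
  _∼_ : Carrier → Carrier → Set ℓ
  x ∼ y = ∃[ k ] x ≈ y ∙ (k · z)

  ≈⇒∼ : ∀ {x y} → x ≈ y → x ∼ y
  ≈⇒∼ x≈y = 0 , ≈-trans x≈y (≈-sym (identityʳ _))

  ∼-trans : ∀ {x y w} → x ∼ y → y ∼ w → x ∼ w
  ∼-trans (k , x≈) (m , y≈) = m + k ,
    ≈-trans x≈ (≈-trans (∙-congʳ y≈) (≈-trans (assoc _ _ _) (∙-congˡ (≈-sym (×-homo-+ z m k)))))

  module _ (s : ℕ) .{{_ : NonZero s}} (s·z≈ε : s · z ≈ ε) where

    open import Relation.Binary.Reasoning.Setoid ≈-setoid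

    ·-ε : ∀ k → k · ε ≈ ε
    ·-ε zero    = ≈-refl
    ·-ε (suc k) = ≈-trans (identityˡ _) (·-ε k)

    [k*s]·z≈ε : ∀ k → (k * s) · z ≈ ε
    [k*s]·z≈ε k = ≈-trans (≈-sym (×-assocˡ z k s)) (≈-trans (×-congʳ k s·z≈ε) (·-ε k))

    ·-% : ∀ k → k · z ≈ (k % s) · z
    ·-% k = begin
      k · z                             ≈⟨ ×-congˡ (m≡m%n+[m/n]*n k s) ⟩
      (k % s + k / s * s) · z           ≈⟨ ×-homo-+ z (k % s) (k / s * s) ⟩
      (k % s) · z ∙ ((k / s * s) · z)   ≈⟨ ∙-congˡ ([k*s]·z≈ε (k / s)) ⟩
      (k % s) · z ∙ ε                   ≈⟨ identityʳ _ ⟩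
      (k % s) · z                       ∎

    ∼-sym : ∀ {x y} → x ∼ y → y ∼ x
    ∼-sym {x} {y} (k , x≈) = k * pred s , ≈-sym (begin
      x ∙ ((k * pred s) · z)                ≈⟨ ∙-congʳ x≈ ⟩
      (y ∙ (k · z)) ∙ ((k * pred s) · z)    ≈⟨ assoc _ _ _ ⟩
      y ∙ ((k · z) ∙ ((k * pred s) · z))    ≈⟨ ∙-congˡ (×-homo-+ z k (k * pred s)) ⟨
      y ∙ ((k + k * pred s) · z)            ≈⟨ ∙-congˡ (×-congˡ (≡.sym (ℕ.*-suc k (pred s)))) ⟩
      y ∙ ((k * suc (pred s)) · z)          ≈⟨ ∙-congˡ (×-congˡ (≡.cong (k *_) (ℕ.suc-pred s))) ⟩
      y ∙ ((k * s) · z)                       ≈⟨ ∙-congˡ ([k*s]·z≈ε k) ⟩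
      y ∙ ε                                   ≈⟨ identityʳ y ⟩
      y                                       ∎)

    ∼-dec : (∀ x y → Dec (x ≈ y)) → ∀ x y → Dec (x ∼ y)
    ∼-dec _≟_ x y = map′
      (λ (k , x≈) → toℕ k , x≈)
      (λ (k , x≈) → k mod s ,
        ≈-trans x≈ (∙-congˡ (≈-trans (·-% k) (×-congˡ (≡.sym (Fin.toℕ-fromℕ< (m%n<n k s)))))))
      (Fin.any? (λ k → x ≟ (y ∙ (toℕ k · z))))

-- Position i of the mathematical indexing 1, …, n is the element of Fin n
-- with toℕ equal to i - 1, and likewise for the values of permutations.
record ColouredPermutation (r n : ℕ) : Set where
  constructor _⨾_
  field
    colour : Fin n → Fin r
    perm   : Permutation′ n

open ColouredPermutation public

module _ (r n : ℕ) .{{_ : NonZero r}} where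

  toℕ-mod : ∀ a → toℕ (a mod r) ≡ a % r
  toℕ-mod a = Fin.toℕ-fromℕ< (m%n<n a r)

  toℕ-% : ∀ (c : Fin r) → toℕ c % r ≡ toℕ c
  toℕ-% c = m<n⇒m%n≡m (Fin.toℕ<n c)

  %-+ˡ : ∀ a b → (a % r + b) % r ≡ (a + b) % r
  %-+ˡ a b = trans (%-distribˡ-+ (a % r) b r)
    (trans (cong (λ x → (x + b % r) % r) (m%n%n≡m%n a r)) (sym (%-distribˡ-+ a b r)))

  %-+ʳ : ∀ a b → (a + b % r) % r ≡ (a + b) % r
  %-+ʳ a b = trans (cong (_% r) (ℕ.+-comm a (b % r)))
    (trans (%-+ˡ b a) (cong (_% r) (ℕ.+-comm b a)))

  infixl 6 _⊞_
  _⊞_ : Fin r → Fin r → Fin r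
  c ⊞ d = (toℕ c + toℕ d) mod r

  0ᶜ : Fin r
  0ᶜ = 0 mod r

  ⊟_ : Fin r → Fin r
  ⊟ c = (r ∸ toℕ c) mod r

  toℕ-0ᶜ : toℕ 0ᶜ ≡ 0
  toℕ-0ᶜ = trans (toℕ-mod 0) (m<n⇒m%n≡m (>-nonZero⁻¹ r))

  ⊞-comm : ∀ a b → a ⊞ b ≡ b ⊞ a
  ⊞-comm a b = cong (_mod r) (ℕ.+-comm (toℕ a) (toℕ b))

  ⊞-assoc : ∀ a b c → (a ⊞ b) ⊞ c ≡ a ⊞ (b ⊞ c)
  ⊞-assoc a b c = Fin.toℕ-injective (begin
    toℕ ((a ⊞ b) ⊞ c)                    ≡⟨ toℕ-mod _ ⟩
    (toℕ (a ⊞ b) + toℕ c) % r            ≡⟨ cong (λ x → (x + toℕ c) % r) (toℕ-mod _) ⟩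
    ((toℕ a + toℕ b) % r + toℕ c) % r    ≡⟨ %-+ˡ (toℕ a + toℕ b) (toℕ c) ⟩
    (toℕ a + toℕ b + toℕ c) % r          ≡⟨ cong (_% r) (ℕ.+-assoc (toℕ a) _ _) ⟩
    (toℕ a + (toℕ b + toℕ c)) % r        ≡⟨ %-+ʳ (toℕ a) (toℕ b + toℕ c) ⟨
    (toℕ a + (toℕ b + toℕ c) % r) % r    ≡⟨ cong (λ x → (toℕ a + x) % r) (toℕ-mod _) ⟨
    (toℕ a + toℕ (b ⊞ c)) % r            ≡⟨ toℕ-mod _ ⟨
    toℕ (a ⊞ (b ⊞ c))                    ∎)
    where open ≡-Reasoning

  ⊞-identityˡ : ∀ a → 0ᶜ ⊞ a ≡ a
  ⊞-identityˡ a = Fin.toℕ-injective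
    (trans (toℕ-mod _) (trans (cong (λ x → (x + toℕ a) % r) toℕ-0ᶜ) (toℕ-% a)))

  ⊞-inverseʳ : ∀ a → a ⊞ (⊟ a) ≡ 0ᶜ
  ⊞-inverseʳ a = Fin.toℕ-injective (begin
    toℕ (a ⊞ (⊟ a))                ≡⟨ toℕ-mod _ ⟩
    (toℕ a + toℕ (⊟ a)) % r        ≡⟨ cong (λ x → (toℕ a + x) % r) (toℕ-mod _) ⟩
    (toℕ a + (r ∸ toℕ a) % r) % r  ≡⟨ %-+ʳ (toℕ a) (r ∸ toℕ a) ⟩
    (toℕ a + (r ∸ toℕ a)) % r      ≡⟨ cong (_% r) (ℕ.m+[n∸m]≡n (ℕ.<⇒≤ (Fin.toℕ<n a))) ⟩
    r % r                          ≡⟨ n%n≡0 r ⟩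
    0                              ≡⟨ toℕ-0ᶜ ⟨
    toℕ 0ᶜ                         ∎)
    where open ≡-Reasoning

  -- _∘ₚ_ composes in diagrammatic order, so σ ∘ₚ τ is the product τσ.
  G[r,n] : Group 0ℓ 0ℓ
  G[r,n] = record
    { Carrier = ColouredPermutation r n
    ; _≈_     = λ g h → (∀ i → colour g i ≡ colour h i) × perm g Perm.≈ perm h
    ; _∙_     = λ { (d ⨾ τ) (c ⨾ σ) → (λ i → c i ⊞ d (σ ⟨$⟩ʳ i)) ⨾ (σ ∘ₚ τ) }
    ; ε       = (λ _ → 0ᶜ) ⨾ Perm.id
    ; _⁻¹     = λ { (c ⨾ σ) → (λ i → ⊟ c (σ ⟨$⟩ˡ i)) ⨾ Perm.flip σ }
    ; isGroup = record
      { isMonoid = record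
        { isSemigroup = record
          { isMagma = record
            { isEquivalence = record
              { refl  = (λ _ → refl) , (λ _ → refl)
              ; sym   = λ (p , q) → (sym ∘ p) , (sym ∘ q)
              ; trans = λ (p , q) (p′ , q′) →
                  (λ i → trans (p i) (p′ i)) , (λ i → trans (q i) (q′ i))
              }
            ; ∙-cong = λ { {d ⨾ τ} {d′ ⨾ τ′} {c ⨾ σ} {c′ ⨾ σ′} (d≗ , τ≗) (c≗ , σ≗) →
                (λ i → cong₂ _⊞_ (c≗ i) (trans (d≗ _) (cong d′ (σ≗ i))))
              , (λ i → trans (τ≗ _) (cong (τ′ ⟨$⟩ʳ_) (σ≗ i))) }
            }
          ; assoc = λ { (e ⨾ υ) (d ⨾ τ) (c ⨾ σ) →
              (λ i → sym (⊞-assoc (c i) (d (σ ⟨$⟩ʳ i)) (e (τ ⟨$⟩ʳ (σ ⟨$⟩ʳ i)))))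
            , (λ _ → refl) }
          }
        ; identity =
            (λ { (c ⨾ σ) → (λ i → trans (⊞-comm (c i) 0ᶜ) (⊞-identityˡ (c i))) , (λ _ → refl) })
          , (λ { (c ⨾ σ) → (λ i → ⊞-identityˡ (c i)) , (λ _ → refl) })
        }
      ; inverse =
          (λ { (c ⨾ σ) →
              (λ i → trans (cong (λ j → c i ⊞ (⊟ c j)) (Perm.inverseˡ σ)) (⊞-inverseʳ (c i)))
            , (λ i → Perm.inverseˡ σ) })
        , (λ { (c ⨾ σ) →
              (λ i → trans (⊞-comm (⊟ c (σ ⟨$⟩ˡ i)) (c (σ ⟨$⟩ˡ i))) (⊞-inverseʳ (c (σ ⟨$⟩ˡ i))))
            , (λ i → Perm.inverseʳ σ) })
      ; ⁻¹-cong = λ { {c ⨾ σ} {c′ ⨾ σ′} (c≗ , σ≗) →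
          let σˡ≗ : ∀ i → σ ⟨$⟩ˡ i ≡ σ′ ⟨$⟩ˡ i
              σˡ≗ i = trans (sym (Perm.inverseˡ σ′))
                (cong (σ′ ⟨$⟩ˡ_) (trans (sym (σ≗ _)) (Perm.inverseʳ σ)))
          in (λ i → cong ⊟_ (trans (c≗ _) (cong c′ (σˡ≗ i)))) , σˡ≗ }
      }
    }

  open Group G[r,n] using (_≈_; _∙_; ε) renaming (setoid to G[r,n]-setoid)

  _≈?_ : ∀ g h → Dec (g ≈ h)
  g ≈? h = Fin.all? (λ i → colour g i Fin.≟ colour h i)
          ×-dec Fin.all? (λ i → (perm g ⟨$⟩ʳ i) Fin.≟ (perm h ⟨$⟩ʳ i))

  inG[r,p,n] : ℕ → ColouredPermutation r n → Set
  inG[r,p,n] p g = p ∣ sumℕ (toℕ ∘ colour g)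

  module _ (s : ℕ) .{{_ : NonZero s}} where

    open MonoidMult (Group.monoid G[r,n]) using () renaming (_×_ to _·_)

    generator : ColouredPermutation r n
    generator = (λ _ → (r / s) mod r) ⨾ Perm.id

    open CyclicCosets G[r,n] generator

    module G = Group G[r,n]

    colour-· : ∀ k i → toℕ (colour (k · generator) i) ≡ (k * (r / s)) % r
    perm-·   : ∀ k i → perm (k · generator) ⟨$⟩ʳ i ≡ i

    colour-· zero    i = toℕ-mod 0
    colour-· (suc k) i = begin
      toℕ (colour (suc k · generator) i)
        ≡⟨ toℕ-mod _ ⟩
      (toℕ (colour (k · generator) i) + toℕ ((r / s) mod r)) % r
        ≡⟨ cong₂ (λ x y → (x + y) % r) (colour-· k i) (toℕ-mod (r / s)) ⟩
      ((k * (r / s)) % r + (r / s) % r) % r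
        ≡⟨ %-distribˡ-+ (k * (r / s)) (r / s) r ⟨
      (k * (r / s) + r / s) % r
        ≡⟨ cong (_% r) (ℕ.+-comm (k * (r / s)) (r / s)) ⟩
      (suc k * (r / s)) % r ∎
      where open ≡-Reasoning

    perm-· zero    i = refl
    perm-· (suc k) i = perm-· k i

    module _ (s∣r : s ∣ r) where

      s·generator≈ε : s · generator ≈ ε
      s·generator≈ε =
          (λ i → Fin.toℕ-injective (begin
            toℕ (colour (s · generator) i) ≡⟨ colour-· s i ⟩
            (s * (r / s)) % r              ≡⟨ cong (_% r) (ℕ.*-comm s (r / s)) ⟩
            ((r / s) * s) % r              ≡⟨ cong (_% r) (m/n*n≡m s∣r) ⟩
            r % r                          ≡⟨ n%n≡0 r ⟩
            0                              ≡⟨ toℕ-0ᶜ ⟨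
            toℕ 0ᶜ                         ∎))
        , perm-· s
        where open ≡-Reasoning

      -- The quotient G(r,p,n) / C_s, as a setoid. Cosets are compared inside
      -- G(r,n); the generator lies in G(r,p,n) as soon as p s ∣ r n.
      G[r,p,s,n] : ℕ → DecSetoid 0ℓ 0ℓ
      G[r,p,s,n] p = record
        { Carrier = Σ[ g ∈ ColouredPermutation r n ] inG[r,p,n] p g
        ; _≈_     = λ (g , _) (h , _) → g ∼ h
        ; isDecEquivalence = record
          { isEquivalence = record
            { refl  = λ {(g , _)} → ≈⇒∼ {g} {g} (G.refl {g})
            ; sym   = λ {(g , _)} {(h , _)} → ∼-sym s s·generator≈ε {g} {h}
            ; trans = λ {(g , _)} {(h , _)} {(l , _)} → ∼-trans {g} {h} {l}
            }
          ; _≟_ = λ (g , _) (h , _) → ∼-dec s s·generator≈ε _≈?_ g h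
          }
        }

      colourings : ∀ n → List (Fin n → Fin r)
      colourings zero    = (λ ()) ∷ []
      colourings (suc n) = cartesianProductWith Vector._∷_ (allFin r) (colourings n)

      permutations : ∀ n → List (Permutation′ n)
      permutations zero    = Perm.id ∷ []
      permutations (suc n) = cartesianProductWith (Perm.insert zero) (allFin (suc n)) (permutations n)

      permSetoid : ℕ → Setoid 0ℓ 0ℓ
      permSetoid n = record
        { Carrier = Permutation′ n
        ; _≈_ = Perm._≈_
        ; isEquivalence = record
          { refl = λ _ → refl
          ; sym = λ p i → sym (p i)
          ; trans = λ p q i → trans (p i) (q i)
          }
        }

      insert-cong : ∀ {m} {a b : Fin (suc m)} {π ρ : Permutation′ m} → a ≡ b → π Perm.≈ ρ →
                    Perm.insert zero a π Perm.≈ Perm.insert zero b ρ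
      insert-cong refl p zero    = refl
      insert-cong {a = a} refl p (suc i) = cong (Fin.punchIn a) (p i)

      colourings-complete : ∀ n → Enumerates.IsEnumeration (Fin n →-setoid Fin r) (colourings n)
      colourings-complete zero    c = here (λ ())
      colourings-complete (suc n) c =
        Any.map (λ c≗ i → trans (η c i) (c≗ i))
          (∈-cartesianProductWith⁺ (setoid (Fin r)) (Fin n →-setoid Fin r) (Fin (suc n) →-setoid Fin r)
            (λ { refl q zero → refl ; refl q (suc i) → q i })
            (∈-allFin (c zero)) (colourings-complete n (c ∘ suc)))
        where
        η : ∀ (c : Fin (suc n) → Fin r) i → c i ≡ (c zero Vector.∷ (c ∘ suc)) i
        η c zero    = refl
        η c (suc i) = refl

      permutations-complete : ∀ n → Enumerates.IsEnumeration (permSetoid n) (permutations n)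
      permutations-complete zero    π = here (λ ())
      permutations-complete (suc n) π =
        Any.map (λ p i → trans (sym (Perm.insert-remove zero π i)) (p i))
          (∈-cartesianProductWith⁺ (setoid (Fin (suc n))) (permSetoid n) (permSetoid (suc n))
            (λ {a} {b} {π} {ρ} → insert-cong {π = π} {ρ})
            (∈-allFin (π ⟨$⟩ʳ zero)) (permutations-complete n (Perm.remove zero π)))

      inG-resp : ∀ p {g h} → g ≈ h → inG[r,p,n] p g → inG[r,p,n] p h
      inG-resp p {g} {h} (c≗ , _) = subst (p ∣_) (sum-cong-≗ (λ i → cong toℕ (c≗ i)))

      restrict : ∀ p → List (ColouredPermutation r n) → List (DecSetoid.Carrier (G[r,p,s,n] p))
      restrict p []       = []
      restrict p (g ∷ gs) with p ∣? sumℕ (toℕ ∘ colour g)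
      ... | yes g∈ = (g , g∈) ∷ restrict p gs
      ... | no  _  = restrict p gs

      restrict-complete : ∀ p {gs} → Enumerates.IsEnumeration G[r,n]-setoid gs →
        Enumerates.IsEnumeration (DecSetoid.setoid (G[r,p,s,n] p)) (restrict p gs)
      restrict-complete p complete (g , g∈) = go _ (complete g)
        where
        go : ∀ gs → Any.Any (g ≈_) gs → Any.Any (λ h → g ∼ proj₁ h) (restrict p gs)
        go (h ∷ hs) x with p ∣? sumℕ (toℕ ∘ colour h) | x
        ... | yes _  | here g≈h  = here (≈⇒∼ {g} {h} g≈h)
        ... | no h∉  | here g≈h  = contradiction (inG-resp p {g} {h} g≈h g∈) h∉
        ... | yes _  | there g∈hs = there (go hs g∈hs)
        ... | no _   | there g∈hs = go hs g∈hs

      -- One representative of each element of G(r,p,s,n): see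
      -- representatives-complete and representatives-unique.
      representatives : ∀ p → List (DecSetoid.Carrier (G[r,p,s,n] p))
      representatives p = deduplicate (DecSetoid._≟_ (G[r,p,s,n] p))
        (restrict p (cartesianProductWith _⨾_ (colourings n) (permutations n)))

      representatives-complete : ∀ p →
        Enumerates.IsEnumeration (DecSetoid.setoid (G[r,p,s,n] p)) (representatives p)
      representatives-complete p = Enumerates.deduplicate⁺ (G[r,p,s,n] p)
        (restrict-complete p λ g →
          ∈-cartesianProductWith⁺ (Fin n →-setoid Fin r) (permSetoid n) G[r,n]-setoid
            {f = _⨾_} _,_ {a = colour g} {b = perm g}
            (colourings-complete n (colour g)) (permutations-complete n (perm g)))

      representatives-unique : ∀ p →
        Unique.Unique (DecSetoid.setoid (G[r,p,s,n] p)) (representatives p)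
      representatives-unique p = Unique.deduplicate-! (G[r,p,s,n] p) _

      -- f is evaluated on representatives, so this is meaningful for f that are
      -- constant on cosets.
      ∑G[r,p,s,n] : ∀ p → (ColouredPermutation r n → PowerSeries) → PowerSeries
      ∑G[r,p,s,n] p f = foldr (λ (g , _) F → f g ⊕ F) 0# (representatives p)

R : (m : ℕ) .{{_ : NonZero m}} → ℤ → ℕ
R m i = i %ℕ m

module Statistics {r n : ℕ} (s : ℕ) .{{_ : NonZero r}} .{{_ : NonZero s}} .{{_ : NonZero n}}
                  (s∣r : s ∣ r) where

  private instance
    r/s≢0 : NonZero (r / s)
    r/s≢0 = >-nonZero (m≥n⇒m/n>0 (∣⇒≤ s∣r))

  -- The descent between positions i and i + 1 is recorded at i; the last
  -- position has no successor j and so is never in HDes.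
  HDes : ColouredPermutation r n → Fin n → Set
  HDes g i = ∃[ j ] (toℕ j ≡ suc (toℕ i)
                     × colour g i ≡ colour g j
                     × (perm g ⟨$⟩ʳ j) Fin.< (perm g ⟨$⟩ʳ i))

  HDes? : ∀ g i → Dec (HDes g i)
  HDes? g i = Fin.any? λ j → (toℕ j ℕ.≟ suc (toℕ i))
    ×-dec (colour g i Fin.≟ colour g j) ×-dec ((perm g ⟨$⟩ʳ j) Fin.<? (perm g ⟨$⟩ʳ i))

  h : ColouredPermutation r n → Fin n → ℕ
  h g i = length (filter (λ j → (i Fin.≤? j) ×-dec HDes? g j) (allFin n))

  -- The downward recursion on i from the last position, as recursion on the
  -- suffixes of the colour word.
  kᶜ : ∀ {m} → (Fin m → Fin r) → Fin m → ℕ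
  kᶜ {suc zero}    c zero    = R (r / s) (ℤ.+ toℕ (c zero))
  kᶜ {suc (suc m)} c zero    =
    kᶜ (c ∘ suc) zero + R r (ℤ.+ toℕ (c zero) ℤ.- ℤ.+ toℕ (c (suc zero)))
  kᶜ {suc (suc m)} c (suc i) = kᶜ (c ∘ suc) i

  k : ColouredPermutation r n → Fin n → ℕ
  k g = kᶜ (colour g)

  lam : ColouredPermutation r n → Fin n → ℕ
  lam g i = r * h g i + k g i

  fmaj : ColouredPermutation r n → ℕ
  fmaj g = sumℕ (lam g)

  first : Fin n
  first = fromℕ< (>-nonZero⁻¹ n)

  des : ColouredPermutation r n → ℕ
  des g = (s * lam g first + r ∸ s) / r

{-# OPTIONS --safe #-}

-- Write m = r/s. The coefficient of t^k q^j on the left counts the words f with n letters in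
-- {0, …, mk}, sum j and p ∣ j. Sort f into weakly decreasing order by a permutation σ that keeps
-- equal letters in order, and read the colours c_i = f(σ(i)) modulo r: this gives an element of
-- G(r,p,n). Consecutive differences of f ∘ σ are congruent to c_i - c_{i+1} modulo r, and are at
-- least r at a descent inside a colour, so that for the image g of (c, σ) in G(r,p,s,n)
--   f(σ(i)) = λ_i(g) + r (a_i + ⋯ + a_{n-1}) + m h
-- with unique a ∈ ℕ^{n-1} and h ∈ ℕ. Conversely g, a and h determine f, and max f ≤ mk means
-- des(g) + s (a_1 + ⋯ + a_{n-1}) + h ≤ k. Hence words correspond to a term of the numerator together
-- with the slack c in this inequality, a and h, which are the exponents in the geometric expansions
-- of the factors of the denominator.

module Submission where

open import Algebra.Bundles using (CommutativeMonoid; CommutativeRing; CommutativeSemiring; Group)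
import Algebra.Construct.Pointwise as Pointwise
import Algebra.Properties.CommutativeMonoid.Sum as CommutativeMonoidSum
import Algebra.Properties.CommutativeSemigroup as CommutativeSemigroupProperties
import Algebra.Properties.Group as GroupProperties
import Algebra.Properties.Monoid.Mult as MonoidMult
import Algebra.Properties.Semiring.Sum as SemiringSum
open import Algebra.Structures.Biased using (isCommutativeMonoidˡ; isCommutativeSemiringˡ)
open import Data.Fin.Base as Fin using (Fin; zero; suc; toℕ; inject₁; fromℕ; fromℕ<; punchIn)
open import Data.Integer.Base using (ℤ; -[1+_]; 0ℤ; 1ℤ)
  renaming (+_ to pos; _+_ to _+ℤ_; _*_ to _*ℤ_; -_ to -ℤ_; _-_ to _-ℤ_)
import Data.Integer.Properties as ℤ
open import Data.Nat.Base using (ℕ; zero; suc; _∸_; NonZero)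
open import Data.Product.Base using (Σ; Σ-syntax; ∃-syntax; _×_; _,_; proj₁; proj₂)
open import Function.Base using (_∘_)
open import Level using (0ℓ)
open import Relation.Binary.PropositionalEquality using (_≡_; module ≡-Reasoning)
import Relation.Binary.PropositionalEquality as ≡
import Relation.Binary.Reasoning.Setoid as SetoidReasoning
open import Defs

-- Power series

-- Both sides are compared by counting. Apart from the factors `1# ⊖ x`, the series that occur have
-- cardinalities as coefficients: `F enumerates w` makes `F` the generating function of a set with a
-- weight in ℕ × ℕ, and two such series agree once the fibres of their weights correspond.
-- Subtraction enters only in the proof that a geometric series inverts `1# ⊖ x`; the fraction is
-- then the numerator times an explicit product of such series.
--
-- The obstacle is the quotient. Its sum runs over chosen representatives, whereas sorting a word
-- gives an element of the coset that need not be the chosen one. Hence words are related to g by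
-- `Compatible`, which allows a common shift κ m of the colours and so holds for a whole coset at
-- once. The colours then fix the last letter only modulo m = r/s, and this is the origin of the
-- term m h and of the factor 1 - tq^(nr/s). The bound on the letters becomes a bound on exponents
-- of t because des(g) is the ceiling of λ_1(g)/m.

module Cauchy {c ℓ} (A : CommutativeSemiring c ℓ) where

  open CommutativeSemiring A renaming (0# to 0ᴬ; 1# to 1ᴬ)
  open CommutativeMonoidSum +-commutativeMonoid using (sum; sum-cong-≋; sum-replicate-zero)
  open CommutativeSemigroupProperties +-commutativeSemigroup using (x∙yz≈y∙xz)
  open SetoidReasoning setoid

  infix 4 _≈∞_
  _≈∞_ : (F G : ℕ → Carrier) → Set ℓ
  F ≈∞ G = ∀ i → F i ≈ G i

  infixl 6 _+∞_
  _+∞_ : (F G : ℕ → Carrier) → ℕ → Carrier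
  (F +∞ G) i = F i + G i

  infixl 7 _*∞_
  _*∞_ : (F G : ℕ → Carrier) → ℕ → Carrier
  (F *∞ G) i = sum {suc i} λ a → F (toℕ a) * G (i ∸ toℕ a)

  0∞ : ℕ → Carrier
  0∞ _ = 0ᴬ

  1∞ : ℕ → Carrier
  1∞ zero    = 1ᴬ
  1∞ (suc _) = 0ᴬ

  shift : (ℕ → Carrier) → ℕ → Carrier
  shift F i = F (suc i)

  *∞-cong : ∀ {F F′ G G′} → F ≈∞ F′ → G ≈∞ G′ → F *∞ G ≈∞ F′ *∞ G′
  *∞-cong F≈ G≈ i = sum-cong-≋ {suc i} λ a → *-cong (F≈ (toℕ a)) (G≈ (i ∸ toℕ a))

  *∞-zeroˡ : ∀ G → 0∞ *∞ G ≈∞ 0∞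
  *∞-zeroˡ G i = trans (sum-cong-≋ {suc i} λ a → zeroˡ (G (i ∸ toℕ a))) (sum-replicate-zero (suc i))

  *∞-identityˡ : ∀ G → 1∞ *∞ G ≈∞ G
  *∞-identityˡ G zero    = trans (+-identityʳ _) (*-identityˡ _)
  *∞-identityˡ G (suc i) = trans (+-cong (*-identityˡ _) (*∞-zeroˡ G i)) (+-identityʳ _)

  *∞-distribʳ : ∀ H F G → (F +∞ G) *∞ H ≈∞ F *∞ H +∞ G *∞ H
  *∞-distribʳ H F G i = trans
    (sum-cong-≋ {suc i} λ a → distribʳ (H (i ∸ toℕ a)) (F (toℕ a)) (G (toℕ a)))
    (CommutativeMonoidSum.∑-distrib-+ +-commutativeMonoid {suc i}
      (λ a → F (toℕ a) * H (i ∸ toℕ a)) (λ a → G (toℕ a) * H (i ∸ toℕ a)))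

  -- The sum unfolds at its first term only. This mirror image splits off the last term instead,
  -- which is what the induction for commutativity meets.
  *∞-shiftʳ : ∀ F G i → (F *∞ G) (suc i) ≈ F (suc i) * G 0 + (F *∞ shift G) i
  *∞-shiftʳ F G zero = begin
    F 0 * G 1 + (F 1 * G 0 + 0ᴬ)   ≈⟨ x∙yz≈y∙xz _ _ _ ⟩
    F 1 * G 0 + (F 0 * G 1 + 0ᴬ)   ∎
  *∞-shiftʳ F G (suc i) = begin
    F 0 * G (suc (suc i)) + (shift F *∞ G) (suc i)
      ≈⟨ +-congˡ (*∞-shiftʳ (shift F) G i) ⟩
    F 0 * G (suc (suc i)) + (F (suc (suc i)) * G 0 + (shift F *∞ shift G) i)
      ≈⟨ x∙yz≈y∙xz _ _ _ ⟩
    F (suc (suc i)) * G 0 + (F *∞ shift G) (suc i) ∎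

  *∞-comm : ∀ F G → F *∞ G ≈∞ G *∞ F
  *∞-comm F G zero    = +-congʳ (*-comm _ _)
  *∞-comm F G (suc i) =
    trans (+-cong (*-comm _ _) (*∞-comm (shift F) G i)) (sym (*∞-shiftʳ G F i))

  *∞-scaleˡ : ∀ x G H → (λ i → x * G i) *∞ H ≈∞ λ i → x * (G *∞ H) i
  *∞-scaleˡ x G H zero = begin
    x * G 0 * H 0 + 0ᴬ     ≈⟨ +-identityʳ _ ⟩
    x * G 0 * H 0          ≈⟨ *-assoc _ _ _ ⟩
    x * (G 0 * H 0)        ≈⟨ *-congˡ (+-identityʳ _) ⟨
    x * (G 0 * H 0 + 0ᴬ)   ∎
  *∞-scaleˡ x G H (suc i) =
    trans (+-cong (*-assoc _ _ _) (*∞-scaleˡ x (shift G) H i)) (sym (distribˡ _ _ _))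

  *∞-assoc : ∀ F G H → (F *∞ G) *∞ H ≈∞ F *∞ (G *∞ H)
  *∞-assoc F G H zero = begin
    (F 0 * G 0 + 0ᴬ) * H 0 + 0ᴬ   ≈⟨ +-congʳ (*-congʳ (+-identityʳ _)) ⟩
    F 0 * G 0 * H 0 + 0ᴬ          ≈⟨ +-congʳ (*-assoc _ _ _) ⟩
    F 0 * (G 0 * H 0) + 0ᴬ        ≈⟨ +-congʳ (*-congˡ (+-identityʳ _)) ⟨
    F 0 * (G 0 * H 0 + 0ᴬ) + 0ᴬ   ∎
  *∞-assoc F G H (suc i) = begin
    (F *∞ G) 0 * H (suc i) + (((λ j → F 0 * shift G j) +∞ shift F *∞ G) *∞ H) i
      ≈⟨ +-cong (trans (*-congʳ (+-identityʳ _)) (*-assoc _ _ _)) (*∞-distribʳ H (λ j → F 0 * shift G j) (shift F *∞ G) i) ⟩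
    F 0 * (G 0 * H (suc i)) + (((λ j → F 0 * shift G j) *∞ H) i + ((shift F *∞ G) *∞ H) i)
      ≈⟨ +-congˡ (+-cong (*∞-scaleˡ (F 0) (shift G) H i) (*∞-assoc (shift F) G H i)) ⟩
    F 0 * (G 0 * H (suc i)) + (F 0 * (shift G *∞ H) i + (shift F *∞ (G *∞ H)) i)
      ≈⟨ +-assoc _ _ _ ⟨
    F 0 * (G 0 * H (suc i)) + F 0 * (shift G *∞ H) i + (shift F *∞ (G *∞ H)) i
      ≈⟨ +-congʳ (distribˡ _ _ _) ⟨
    F 0 * (G *∞ H) (suc i) + (shift F *∞ (G *∞ H)) i ∎

  -- The result is again of the kind assumed of `A`, so the construction can be iterated: from ℤ to
  -- series in q, and from these to series in t and q. The laws of the double convolution then cost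
  -- no double sums.
  commutativeSemiring : CommutativeSemiring c ℓ
  commutativeSemiring = record
    { Carrier = ℕ → Carrier
    ; _≈_ = _≈∞_
    ; _+_ = _+∞_
    ; _*_ = _*∞_
    ; 0# = 0∞
    ; 1# = 1∞
    ; isCommutativeSemiring = isCommutativeSemiringˡ record
      { +-isCommutativeMonoid = Pointwise.isCommutativeMonoid ℕ +-isCommutativeMonoid
      ; *-isCommutativeMonoid = isCommutativeMonoidˡ record
        { isSemigroup = record
          { isMagma = record
            { isEquivalence = Pointwise.isEquivalence ℕ isEquivalence
            ; ∙-cong = *∞-cong
            }
          ; assoc = *∞-assoc
          }
        ; identityˡ = *∞-identityˡ
        ; comm = *∞-comm
        }
      ; distribʳ = *∞-distribʳ
      ; zeroˡ = *∞-zeroˡ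
      }
    }

private
  module ℤ[[q]] = CommutativeSemiring (Cauchy.commutativeSemiring ℤ.+-*-commutativeSemiring)
  module ℤ[[t,q]] = CommutativeSemiring
    (Cauchy.commutativeSemiring (Cauchy.commutativeSemiring ℤ.+-*-commutativeSemiring))

open CommutativeMonoidSum ℤ.+-0-commutativeMonoid using () renaming (sum to sumℤ)
open CommutativeMonoidSum ℤ[[q]].+-commutativeMonoid using () renaming (sum to sumq)

sumq-coefficient : ∀ n (f : Fin n → ℤ[[q]].Carrier) j → sumq f j ≡ sumℤ (λ a → f a j)
sumq-coefficient zero    f j = ≡.refl
sumq-coefficient (suc n) f j = ≡.cong (λ x → f zero j +ℤ x) (sumq-coefficient n (λ a → f (suc a)) j)

-- `⊛` is a double sum of integers, the iterated product a sum of series in q. Taking a coefficient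
-- commutes with finite sums.
⊛≋* : ∀ F G → F ⊛ G ≋ F ℤ[[t,q]].* G
⊛≋* F G i j = ≡.sym (sumq-coefficient (suc i) (λ a → F (toℕ a) ℤ[[q]].* G (i ∸ toℕ a)) j)

1#≋1 : 1# ≋ ℤ[[t,q]].1#
1#≋1 zero    zero    = ≡.refl
1#≋1 zero    (suc j) = ≡.refl
1#≋1 (suc i) j       = ≡.refl

⊛-commutativeMonoid : CommutativeMonoid 0ℓ 0ℓ
⊛-commutativeMonoid = record
  { Carrier = PowerSeries
  ; _≈_ = _≋_
  ; _∙_ = _⊛_
  ; ε = 1#
  ; isCommutativeMonoid = isCommutativeMonoidˡ record
    { isSemigroup = record
      { isMagma = record
        { isEquivalence = isEquivalence
        ; ∙-cong = λ {F} {F′} {G} {G′} F≋ G≋ → begin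
            F ⊛ G    ≈⟨ ⊛≋* F G ⟩
            F * G    ≈⟨ *-cong {F} {F′} {G} {G′} F≋ G≋ ⟩
            F′ * G′  ≈⟨ ⊛≋* F′ G′ ⟨
            F′ ⊛ G′  ∎
        }
      ; assoc = λ F G H → begin
          (F ⊛ G) ⊛ H  ≈⟨ ⊛≋* (F ⊛ G) H ⟩
          (F ⊛ G) * H  ≈⟨ *-cong {F ⊛ G} {F * G} {H} {H} (⊛≋* F G) (refl {H}) ⟩
          (F * G) * H  ≈⟨ *-assoc F G H ⟩
          F * (G * H)  ≈⟨ *-cong {F} {F} {G ⊛ H} {G * H} (refl {F}) (⊛≋* G H) ⟨
          F * (G ⊛ H)  ≈⟨ ⊛≋* F (G ⊛ H) ⟨
          F ⊛ (G ⊛ H)  ∎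
      }
    ; identityˡ = λ F → begin
        1# ⊛ F  ≈⟨ ⊛≋* 1# F ⟩
        1# * F  ≈⟨ *-cong {1#} {𝟙} {F} {F} 1#≋1 (refl {F}) ⟩
        𝟙 * F   ≈⟨ *-identityˡ F ⟩
        F       ∎
    ; comm = λ F G → begin
        F ⊛ G  ≈⟨ ⊛≋* F G ⟩
        F * G  ≈⟨ *-comm F G ⟩
        G * F  ≈⟨ ⊛≋* G F ⟨
        G ⊛ F  ∎
    }
  }
  where
  open ℤ[[t,q]] hiding (0#) renaming (1# to 𝟙)
  open SetoidReasoning setoid

⊛-distribʳ-⊕ : ∀ H F G → (F ⊕ G) ⊛ H ≋ (F ⊛ H) ⊕ (G ⊛ H)
⊛-distribʳ-⊕ H F G = begin
  (F ⊕ G) ⊛ H         ≈⟨ ⊛≋* (F ⊕ G) H ⟩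
  (F ⊕ G) * H         ≈⟨ distribʳ H F G ⟩
  (F * H) ⊕ (G * H)   ≈⟨ +-cong {F ⊛ H} {F * H} {G ⊛ H} {G * H} (⊛≋* F H) (⊛≋* G H) ⟨
  (F ⊛ H) ⊕ (G ⊛ H)   ∎
  where
  open ℤ[[t,q]] hiding (0#; 1#)
  open SetoidReasoning setoid

private
  module ⊛ = CommutativeMonoid ⊛-commutativeMonoid

⊛-inverse : ∀ {F F⁻¹ G G⁻¹} → F ⊛ F⁻¹ ≋ 1# → G ⊛ G⁻¹ ≋ 1# → (F ⊛ G) ⊛ (F⁻¹ ⊛ G⁻¹) ≋ 1#
⊛-inverse {F} {F⁻¹} {G} {G⁻¹} FF⁻¹ GG⁻¹ = begin
  (F ⊛ G) ⊛ (F⁻¹ ⊛ G⁻¹)   ≈⟨ interchange F G F⁻¹ G⁻¹ ⟩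
  (F ⊛ F⁻¹) ⊛ (G ⊛ G⁻¹)   ≈⟨ ⊛.∙-cong {F ⊛ F⁻¹} {1#} {G ⊛ G⁻¹} {1#} FF⁻¹ GG⁻¹ ⟩
  1# ⊛ 1#                 ≈⟨ ⊛.identityˡ 1# ⟩
  1#                      ∎
  where
  open SetoidReasoning ⊛.setoid
  open CommutativeSemigroupProperties ⊛.commutativeSemigroup using (interchange)

∏-inverse : ∀ {n} (F F⁻¹ : Fin n → PowerSeries) → (∀ i → F i ⊛ F⁻¹ i ≋ 1#) → ∏ F ⊛ ∏ F⁻¹ ≋ 1#
∏-inverse {zero}  F F⁻¹ FF⁻¹ = ⊛.identityˡ 1#
∏-inverse {suc n} F F⁻¹ FF⁻¹ = ⊛-inverse {F zero} {F⁻¹ zero} {∏ (λ i → F (suc i))} {∏ (λ i → F⁻¹ (suc i))} (FF⁻¹ zero)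
  (∏-inverse (λ i → F (suc i)) (λ i → F⁻¹ (suc i)) (λ i → FF⁻¹ (suc i)))

-- x ⊛ E cancels from 1# ⊕ (x ⊛ E) ≋ E ≋ ((1# ⊖ x) ⊕ x) ⊛ E.
geometric-inverse : ∀ {x E} → E ≋ 1# ⊕ (x ⊛ E) → (1# ⊖ x) ⊛ E ≋ 1#
geometric-inverse {x} {E} E≋ i j = ∙-cancelʳ _ _ _ (begin
  ((1# ⊖ x) ⊛ E) i j +ℤ (x ⊛ E) i j   ≡⟨ ⊛-distribʳ-⊕ E (1# ⊖ x) x i j ⟨
  (((1# ⊖ x) ⊕ x) ⊛ E) i j           ≡⟨ ⊛.∙-cong {(1# ⊖ x) ⊕ x} {1#} {E} {E} cancel (λ _ _ → ≡.refl) i j ⟩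
  (1# ⊛ E) i j                       ≡⟨ ⊛.identityˡ E i j ⟩
  E i j                              ≡⟨ E≋ i j ⟩
  1# i j +ℤ (x ⊛ E) i j               ∎)
  where
  open GroupProperties (CommutativeRing.+-group ℤ.+-*-commutativeRing) using (∙-cancelʳ; //-rightDividesˡ)
  open ≡-Reasoning
  cancel : (1# ⊖ x) ⊕ x ≋ 1#
  cancel i j = //-rightDividesˡ (x i j) (1# i j)

open import Data.Bool.Base using (Bool; true; false; if_then_else_; _∧_)
open import Data.Bool.Properties using (T-irrelevant)
open import Data.Fin.Induction using (<-weakInduction)
open import Data.Fin.Permutation as Perm using (Permutation′; _⟨$⟩ʳ_; _⟨$⟩ˡ_)
import Data.Fin.Properties as Fin
open import Data.Integer.DivMod using (_%ℕ_; _/ℕ_; n%ℕd<d; a≡a%ℕn+[a/ℕn]*n)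
open import Data.List.Base as List using (List; []; _∷_; foldr; length)
open import Data.List.Membership.Propositional.Properties using (∈-lookup)
import Data.List.Relation.Unary.All as All
open import Data.List.Relation.Unary.AllPairs using ([]; _∷_)
import Data.List.Relation.Unary.Any as Any
open import Data.List.Relation.Unary.Any.Properties using (lookup-index)
open import Data.List.Relation.Unary.Enumerates.Setoid using (IsEnumeration)
open import Data.List.Relation.Unary.Unique.Setoid using (Unique)
open import Data.Nat.Base
  using (_+_; _*_; _≤_; _<_; pred; z≤n; s≤s; >-nonZero; >-nonZero⁻¹)
open import Data.Nat.DivMod
open import Data.Nat.Divisibility
  using (_∣_; _∣?_; divides; ∣⇒≤; ∣-trans; n∣m*n; ∣m∣n⇒∣m+n; *-cancelʳ-∣; m%n≡0⇒n∣m; n∣m⇒m%n≡0)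
import Data.Nat.Properties as ℕ
open import Data.Nat.Tactic.RingSolver using (solve-∀)
open import Data.Product.Function.NonDependent.Propositional using (_×-cong_)
open import Data.Product.Properties using (≡-dec)
open import Data.Sum.Base as Sum using (_⊎_; inj₁; inj₂; [_,_])
open import Data.Sum.Function.Propositional using (_⊎-cong_)
open import Data.Unit.Base using (⊤; tt)
open import Data.Vec.Base using (Vec; []; _∷_; lookup; tabulate)
open import Data.Vec.Properties using (lookup∘tabulate; tabulate∘lookup; tabulate-cong)
open import Function.Bundles using (_↔_; mk↔ₛ′)
open import Function.Properties.Inverse using (↔-sym; ↔-trans)
open import Relation.Binary.Bundles using (DecSetoid; Setoid)
open import Relation.Binary.Core using (Rel)
open import Relation.Binary.Definitions using (Irreflexive; Transitive; tri<; tri≈; tri>)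
open import Relation.Binary.PropositionalEquality
  using (_≢_; _≗_; refl; sym; trans; cong; cong₂; subst; subst₂)
open import Relation.Nullary using (Dec; yes; no; does; ¬_; ⌊_⌋; contradiction; Irrelevant)
open import Relation.Nullary.Decidable using (True; toWitness; fromWitness; map′; dec-true; dec-false; _×-dec_)
open import Relation.Unary using (Decidable)
open CommutativeMonoidSum ℕ.+-0-commutativeMonoid
  using (sum-cong-≗; sum-permute; ∑-distrib-+; sum-replicate-zero) renaming (sum to sumℕ)
open SemiringSum ℕ.+-*-semiring using (*-distribˡ-sum)

-- Counting

bijective⇒↔ : ∀ {X Y : Set} (f : X → Y) → (∀ {x x′} → f x ≡ f x′ → x ≡ x′) →
              (∀ y → ∃[ x ] f x ≡ y) → X ↔ Y
bijective⇒↔ f f-injective f-surjective = mk↔ₛ′ f (proj₁ ∘ f-surjective) (proj₂ ∘ f-surjective)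
  (λ x → f-injective (proj₂ (f-surjective (f x))))

infix 0 _counts_
-- Coefficients are integers, but bijections compare finite sets. Through `counts-unique`, a
-- bijection becomes an equality of integers.
_counts_ : ℤ → Set → Set
z counts X = ∃[ c ] z ≡ pos c × (Fin c ↔ X)

module _ {X Y : Set} where

  counts-resp-↔ : ∀ {z} → z counts X → X ↔ Y → z counts Y
  counts-resp-↔ (c , z≡ , Fin↔X) X↔Y = c , z≡ , ↔-trans Fin↔X X↔Y

  counts-unique : ∀ {z z′} → z counts X → z′ counts Y → X ↔ Y → z ≡ z′
  counts-unique (c , z≡ , Fin↔X) (c′ , z′≡ , Fin↔Y) X↔Y = trans z≡ (trans
    (cong pos (Perm.↔⇒≡ (↔-trans Fin↔X (↔-trans X↔Y (↔-sym Fin↔Y))))) (sym z′≡))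

  counts-⊎ : ∀ {z z′} → z counts X → z′ counts Y → z +ℤ z′ counts X ⊎ Y
  counts-⊎ (c , refl , Fin↔X) (c′ , refl , Fin↔Y) =
    c + c′ , refl , ↔-trans Fin.+↔⊎ (Fin↔X ⊎-cong Fin↔Y)

  counts-× : ∀ {z z′} → z counts X → z′ counts Y → z *ℤ z′ counts X × Y
  counts-× (c , refl , Fin↔X) (c′ , refl , Fin↔Y) =
    c * c′ , sym (ℤ.pos-* c c′) , ↔-trans Fin.*↔× (Fin↔X ×-cong Fin↔Y)

counts-empty : ∀ {X : Set} → ¬ X → 0ℤ counts X
counts-empty ¬x = 0 , refl , mk↔ₛ′ (λ ()) (λ x → contradiction x ¬x) (λ x → contradiction x ¬x) (λ ())

counts-singleton : ∀ {X : Set} (x : X) → (∀ y → x ≡ y) → 1ℤ counts X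
counts-singleton x x≡ = 1 , refl , mk↔ₛ′ (λ _ → x) (λ _ → zero) x≡ (λ { zero → refl })

counts-Dec : ∀ {X : Set} (X? : Dec X) → Irrelevant X → (if ⌊ X? ⌋ then 1ℤ else 0ℤ) counts X
counts-Dec (yes x) irr = counts-singleton x (irr x)
counts-Dec (no ¬x) irr = counts-empty ¬x

counts-Σ : ∀ {n} {z : Fin n → ℤ} {X : Fin n → Set} → (∀ a → z a counts X a) → sumℤ z counts Σ (Fin n) X
counts-Σ {zero}          _       = counts-empty λ ()
counts-Σ {suc n} {X = X} z-counts = counts-resp-↔ (counts-⊎ (z-counts zero) (counts-Σ (z-counts ∘ suc)))
  (mk↔ₛ′ [ (λ x → zero , x) , (λ (a , x) → suc a , x) ]
    (λ { (zero , x) → inj₁ x ; (suc a , x) → inj₂ (a , x) })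
    (λ { (zero , x) → refl ; (suc a , x) → refl })
    [ (λ _ → refl) , (λ _ → refl) ])

-- Generating functions of weighted sets

Fibre : {X : Set} → (X → ℕ × ℕ) → ℕ → ℕ → Set
Fibre w i j = ∃[ x ] w x ≡ (i , j)

Fibre-≡ : ∀ {X : Set} {w : X → ℕ × ℕ} {i j} {x y : Fibre w i j} → proj₁ x ≡ proj₁ y → x ≡ y
Fibre-≡ {x = x , refl} {.x , refl} refl = refl

Fibre-↔ : ∀ {X Y : Set} {w : X → ℕ × ℕ} {v : Y → ℕ × ℕ} (f : X → Y) →
          (∀ {x x′} → f x ≡ f x′ → x ≡ x′) → (∀ y → ∃[ x ] f x ≡ y) → (∀ x → v (f x) ≡ w x) →
          ∀ i j → Fibre w i j ↔ Fibre v i j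
Fibre-↔ {w = w} {v} f f-injective f-surjective v∘f i j = bijective⇒↔
  (λ (x , wx≡) → f x , trans (v∘f x) wx≡)
  (λ eq → Fibre-≡ (f-injective (cong proj₁ eq)))
  (λ (y , vy≡) → let x , fx≡y = f-surjective y in
    (x , trans (sym (v∘f x)) (trans (cong v fx≡y) vy≡)) , Fibre-≡ fx≡y)

infixl 6 _⊹_
_⊹_ : ℕ × ℕ → ℕ × ℕ → ℕ × ℕ
(a , b) ⊹ (c , d) = a + c , b + d

infix 4 _enumerates_
-- `F` is the generating function of `X` by weight, all fibres being finite. As a record it lets `F`
-- and `w` be inferred from a proof.
record _enumerates_ {X : Set} (F : PowerSeries) (w : X → ℕ × ℕ) : Set where
  field
    coefficient : ∀ i j → F i j counts Fibre w i j

open _enumerates_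

module _ {X Y : Set} {w : X → ℕ × ℕ} {v : Y → ℕ × ℕ} where

  enumerates-unique : ∀ {F G} → F enumerates w → G enumerates v → (∀ i j → Fibre w i j ↔ Fibre v i j) → F ≋ G
  enumerates-unique F-enum G-enum w↔v i j = counts-unique (coefficient F-enum i j) (coefficient G-enum i j) (w↔v i j)

  enumerates-resp-↔ : ∀ {F} → F enumerates w → (∀ i j → Fibre w i j ↔ Fibre v i j) → F enumerates v
  enumerates-resp-↔ F-enum w↔v .coefficient i j = counts-resp-↔ (coefficient F-enum i j) (w↔v i j)

  enumerates-⊕ : ∀ {F G} → F enumerates w → G enumerates v → F ⊕ G enumerates [ w , v ]
  enumerates-⊕ F-enum G-enum .coefficient i j = counts-resp-↔ (counts-⊎ (coefficient F-enum i j) (coefficient G-enum i j))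
    (mk↔ₛ′ [ (λ (x , eq) → inj₁ x , eq) , (λ (y , eq) → inj₂ y , eq) ]
    (λ { (inj₁ x , eq) → inj₁ (x , eq) ; (inj₂ y , eq) → inj₂ (y , eq) })
    (λ { (inj₁ x , eq) → refl ; (inj₂ y , eq) → refl })
    [ (λ _ → refl) , (λ _ → refl) ])

  -- A pair of total weight `(i , j)` determines its place in the convolution: `a` and `b` are the
  -- components of `w x`. So the double sum counts each pair exactly once.
  enumerates-⊛ : ∀ {F G} → F enumerates w → G enumerates v → F ⊛ G enumerates λ (x , y) → w x ⊹ v y
  enumerates-⊛ F-enum G-enum .coefficient i j = counts-resp-↔
    (counts-Σ λ a → counts-Σ λ b → counts-×
      (coefficient F-enum (toℕ a) (toℕ b)) (coefficient G-enum (i ∸ toℕ a) (j ∸ toℕ b)))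
    (bijective⇒↔ to to-injective to-surjective)
    where
    Split = Σ[ a ∈ Fin (suc i) ] Σ[ b ∈ Fin (suc j) ] (Fibre w (toℕ a) (toℕ b) × Fibre v (i ∸ toℕ a) (j ∸ toℕ b))

    to : Split → Fibre (λ (x , y) → w x ⊹ v y) i j
    to (a , b , (x , wx≡) , (y , vy≡)) = (x , y) , trans (cong₂ _⊹_ wx≡ vy≡)
      (cong₂ _,_ (ℕ.m+[n∸m]≡n (ℕ.≤-pred (Fin.toℕ<n a))) (ℕ.m+[n∸m]≡n (ℕ.≤-pred (Fin.toℕ<n b))))

    to-injective : ∀ {p q} → to p ≡ to q → p ≡ q
    to-injective {a , b , (x , wx≡) , (y , vy≡)} {a′ , b′ , (x′ , wx′≡) , (y′ , vy′≡)} eq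
      with refl ← cong proj₁ eq
      with refl ← Fin.toℕ-injective (cong proj₁ (trans (sym wx≡) wx′≡))
         | refl ← Fin.toℕ-injective (cong proj₂ (trans (sym wx≡) wx′≡))
      = cong₂ (λ p q → a , b , p , q) (Fibre-≡ refl) (Fibre-≡ refl)

    to-surjective : ∀ q → ∃[ p ] to p ≡ q
    to-surjective ((x , y) , refl) =
      (a , b , (x , cong₂ _,_ (sym a≡) (sym b≡)) , (y , cong₂ _,_ (v≡ a≡) (v≡ b≡))) , Fibre-≡ refl
      where
      a<i = s≤s (ℕ.m≤m+n (proj₁ (w x)) (proj₁ (v y)))
      b<j = s≤s (ℕ.m≤m+n (proj₂ (w x)) (proj₂ (v y)))
      a = fromℕ< a<i
      b = fromℕ< b<j
      a≡ : toℕ a ≡ proj₁ (w x)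
      a≡ = Fin.toℕ-fromℕ< a<i
      b≡ : toℕ b ≡ proj₂ (w x)
      b≡ = Fin.toℕ-fromℕ< b<j
      v≡ : ∀ {c d e} → c ≡ d → e ≡ d + e ∸ c
      v≡ {c} {e = e} refl = sym (ℕ.m+n∸m≡n c e)

enumerates-monomial : ∀ a b → t^ a q^ b enumerates λ (_ : ⊤) → a , b
enumerates-monomial a b .coefficient i j with i ℕ.≟ a | j ℕ.≟ b
... | yes refl | yes refl = counts-singleton (tt , refl) (λ _ → Fibre-≡ refl)
... | yes _    | no j≢b   = counts-empty (λ { (tt , refl) → contradiction refl j≢b })
... | no i≢a   | _        = counts-empty (λ { (tt , refl) → contradiction refl i≢a })

⟨∑⟩ : ∀ {n} → (Fin n → ℕ × ℕ) → ℕ × ℕ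
⟨∑⟩ w = sumℕ (proj₁ ∘ w) , sumℕ (proj₂ ∘ w)

enumerates-∏ : ∀ {X : Set} {n} {F : Fin n → PowerSeries} {w : Fin n → X → ℕ × ℕ} →
               (∀ i → F i enumerates w i) →
               ∏ F enumerates λ (v : Vec X n) → ⟨∑⟩ λ i → w i (lookup v i)
enumerates-∏ {n = zero}  F-enum = enumerates-resp-↔ (enumerates-monomial 0 0)
  (Fibre-↔ (λ _ → []) (λ _ → refl) (λ { [] → tt , refl }) (λ _ → refl))
enumerates-∏ {n = suc n} F-enum = enumerates-resp-↔ (enumerates-⊛ (F-enum zero) (enumerates-∏ (F-enum ∘ suc)))
  (Fibre-↔ (λ (x , v) → x ∷ v) (λ { refl → refl }) (λ { (x ∷ v) → (x , v) , refl }) (λ _ → refl))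

↑≡∏ : ∀ F n → F ↑ n ≡ ∏ {n} λ _ → F
↑≡∏ F zero    = refl
↑≡∏ F (suc n) = cong (F ⊛_) (↑≡∏ F n)

module _ {A : Set} (w : A → ℕ × ℕ) where

  private
    x^ : A → PowerSeries
    x^ a = t^ proj₁ (w a) q^ proj₂ (w a)

  enumerates-∑-monomials : ∀ {n} (f : Fin n → A) → ∑ (x^ ∘ f) enumerates w ∘ f
  enumerates-∑-monomials {zero}  f .coefficient i j = counts-empty λ ()
  enumerates-∑-monomials {suc n} f = enumerates-resp-↔
    (enumerates-⊕ (enumerates-monomial _ _) (enumerates-∑-monomials (f ∘ suc)))
    (Fibre-↔ [ (λ _ → zero) , suc ]
      (λ { {inj₁ _} {inj₁ _} _ → refl ; {inj₂ _} {inj₂ _} refl → refl })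
      (λ { zero → inj₁ tt , refl ; (suc a) → inj₂ a , refl })
      [ (λ _ → refl) , (λ _ → refl) ])

  ∑-lookup : ∀ as → foldr (λ a F → x^ a ⊕ F) 0# as ≡ ∑ (x^ ∘ List.lookup as)
  ∑-lookup []       = refl
  ∑-lookup (a ∷ as) = cong (x^ a ⊕_) (∑-lookup as)

enumerates-∑t^ : ∀ {X : ℕ → Set} {F : ℕ → PowerSeries} {w : ∀ k → X k → ℕ × ℕ} →
                 (∀ k → F k enumerates w k) → ∑t^ F enumerates λ ((k , x) : Σ ℕ X) → (k , 0) ⊹ w k x
enumerates-∑t^ {X} {F} {w} F-enum .coefficient i j = counts-resp-↔
  (counts-Σ {suc i} λ k → coefficient (F-enum (toℕ k)) (i ∸ toℕ k) j)
  (bijective⇒↔ to to-injective to-surjective)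
  where
  to : (Σ[ k ∈ Fin (suc i) ] Fibre (w (toℕ k)) (i ∸ toℕ k) j) → Fibre (λ ((k , x) : Σ ℕ X) → (k , 0) ⊹ w k x) i j
  to (k , x , wx≡) = (toℕ k , x) , trans (cong ((toℕ k , 0) ⊹_) wx≡)
    (cong (_, j) (ℕ.m+[n∸m]≡n (ℕ.≤-pred (Fin.toℕ<n k))))

  to-injective : ∀ {p q} → to p ≡ to q → p ≡ q
  to-injective {k , x , wx≡} {k′ , x′ , wx′≡} eq
    with refl ← Fin.toℕ-injective (cong (proj₁ ∘ proj₁) eq)
    with refl ← cong proj₁ eq = cong (k ,_) (Fibre-≡ refl)

  to-surjective : ∀ q → ∃[ p ] to p ≡ q
  to-surjective ((k , x) , eq) = lift (fromℕ< k<i) (Fin.toℕ-fromℕ< k<i) eq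
    where
    k<i = s≤s (ℕ.m+n≤o⇒m≤o k (ℕ.≤-reflexive (cong proj₁ eq)))
    -- The index is generalised to any `k′` lying over `k`: `toℕ (fromℕ< k<i)` does not reduce to
    -- `k`, and the type of `x` depends on `k`.
    lift : ∀ {k x} (k′ : Fin (suc i)) → toℕ k′ ≡ k → (eq : (k , 0) ⊹ w k x ≡ (i , j)) → ∃[ p ] to p ≡ ((k , x) , eq)
    lift {x = x} k′ refl eq = (k′ , x , trans (cong (_, proj₂ (w _ x)) (sym (ℕ.m+n∸m≡n (toℕ k′) _)))
      (cong (λ (a , b) → a ∸ toℕ k′ , b) eq)) , Fibre-≡ refl

-- Divisibility is carried as `True`, whose proofs are equal by `T-irrelevant`, so an element of `X`
-- occurs at most once in the restricted set.
enumerates-⟦⟧ : ∀ {X : Set} {F} {w : X → ℕ × ℕ} p → F enumerates w →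
                ⟦ F ⟧q^ p enumerates λ ((x , _) : Σ[ x ∈ X ] True (p ∣? proj₂ (w x))) → w x
enumerates-⟦⟧ {X} {w = w} p F-enum .coefficient i j with p ∣? j
... | yes p∣j = counts-resp-↔ (coefficient F-enum i j) (bijective⇒↔
  (λ (x , wx≡) → (x , fromWitness (subst (p ∣_) (sym (cong proj₂ wx≡)) p∣j)) , wx≡)
  (λ eq → Fibre-≡ (cong (proj₁ ∘ proj₁) eq))
  (λ ((x , _) , wx≡) → (x , wx≡) , Fibre-≡ (Subset-≡ refl)))
  where
  Subset-≡ : {x y : Σ[ x ∈ X ] True (p ∣? proj₂ (w x))} → proj₁ x ≡ proj₁ y → x ≡ y
  Subset-≡ refl = cong (_ ,_) (T-irrelevant _ _)
... | no p∤j = counts-empty (λ ((x , p∣) , wx≡) →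
  contradiction (subst (p ∣_) (cong proj₂ wx≡) (toWitness p∣)) p∤j)

-- Geometric series

module _ (a b : ℕ) .{{_ : NonZero a}} where

  multiples : ℕ → ℕ × ℕ
  multiples m = m * a , m * b

  private
    multiples-injective : ∀ {m n} → multiples m ≡ multiples n → m ≡ n
    multiples-injective eq = ℕ.*-cancelʳ-≡ _ _ a (cong proj₁ eq)

    Fibre? : ∀ i j → Dec (Fibre multiples i j)
    Fibre? i j = map′ (i / a ,_)
      (λ { (m , refl) → cong multiples (m*n/n≡m m a) })
      (≡-dec ℕ._≟_ ℕ._≟_ (multiples (i / a)) (i , j))

  -- The expansion of 1 / (1 - t^a q^b). Since `a` is nonzero, the t-degree `i` leaves `i / a` as
  -- the only candidate for the power, so each coefficient is 0 or 1 and decidable.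
  geometric : PowerSeries
  geometric i j = if ⌊ Fibre? i j ⌋ then 1ℤ else 0ℤ

  enumerates-geometric : geometric enumerates multiples
  enumerates-geometric .coefficient i j = counts-Dec (Fibre? i j)
    (λ (m , m≡) (n , n≡) → Fibre-≡ (multiples-injective (trans m≡ (sym n≡))))

  1⊖-inverse : (1# ⊖ t^ a q^ b) ⊛ geometric ≋ 1#
  1⊖-inverse = geometric-inverse {t^ a q^ b} {geometric} (enumerates-unique enumerates-geometric
    (enumerates-⊕ (enumerates-monomial 0 0) (enumerates-⊛ (enumerates-monomial a b) enumerates-geometric))
    -- A power is either 0 or a successor: on generating functions this is E = 1 + x E.
    (Fibre-↔ (λ { zero → inj₁ tt ; (suc m) → inj₂ (tt , m) })
      (λ { {zero} {zero} _ → refl ; {suc _} {suc _} refl → refl })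
      [ (λ _ → 0 , refl) , (λ (_ , m) → suc m , refl) ]
      (λ { zero → refl ; (suc m) → refl })))

-- A bijection given by its graph: each of its four properties can be proved from the relation
-- alone, without computing with the maps in either direction.
Fibre-↔-relation : ∀ {X Y : Set} {w : X → ℕ × ℕ} {v : Y → ℕ × ℕ} (_~_ : X → Y → Set) →
                   (∀ x → ∃[ y ] x ~ y) → (∀ y → ∃[ x ] x ~ y) →
                   (∀ {x y y′} → x ~ y → x ~ y′ → y ≡ y′) → (∀ {x x′ y} → x ~ y → x′ ~ y → x ≡ x′) →
                   (∀ {x y} → x ~ y → v y ≡ w x) → ∀ i j → Fibre w i j ↔ Fibre v i j
Fibre-↔-relation _~_ total surjective functional injective weights = Fibre-↔ (proj₁ ∘ total)
  (λ {x} {x′} eq → injective (proj₂ (total x)) (subst (x′ ~_) (sym eq) (proj₂ (total x′))))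
  (λ y → let x , x~y = surjective y in x , functional (proj₂ (total x)) x~y)
  (λ x → weights (proj₂ (total x)))

module _ {c ℓ} (S : Setoid c ℓ) where

  open Setoid S using (_≈_) renaming (sym to ≈-sym)

  lookup-injective : ∀ {xs} → Unique S xs → ∀ i j → List.lookup xs i ≈ List.lookup xs j → i ≡ j
  lookup-injective (x≉ ∷ xs!) zero    zero    _  = refl
  lookup-injective (x≉ ∷ xs!) zero    (suc j) eq = contradiction eq (All.lookup x≉ (∈-lookup j))
  lookup-injective (x≉ ∷ xs!) (suc i) zero    eq = contradiction (≈-sym eq) (All.lookup x≉ (∈-lookup i))
  lookup-injective (x≉ ∷ xs!) (suc i) (suc j) eq = cong suc (lookup-injective xs! i j eq)

lookup-extensional : ∀ {A : Set} {n} {u v : Vec A n} → lookup u ≗ lookup v → u ≡ v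
lookup-extensional {u = u} {v} u≗v =
  trans (sym (tabulate∘lookup u)) (trans (tabulate-cong u≗v) (tabulate∘lookup v))

-- Sorting permutations

module _ {A : Set} {_≺_ : Rel A 0ℓ} (≺-trans : Transitive _≺_) where

  chain : ∀ {n} (a : Fin (suc n) → A) → (∀ i → a (inject₁ i) ≺ a (suc i)) →
          ∀ {i j} → i Fin.< j → a i ≺ a j
  chain {suc n} a step {zero}  {suc zero}    _         = step zero
  chain {suc n} a step {zero}  {suc (suc j)} _         =
    ≺-trans {j = a (suc zero)} (step zero) (chain (a ∘ suc) (step ∘ suc) {zero} {suc j} (s≤s z≤n))
  chain {suc n} a step {suc i} {suc j}       (s≤s i<j) = chain (a ∘ suc) (step ∘ suc) i<j

Sorts : ∀ {n} → Rel (Fin n) 0ℓ → Permutation′ n → Set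
Sorts _≺_ σ = ∀ {i j} → i Fin.< j → (σ ⟨$⟩ʳ i) ≺ (σ ⟨$⟩ʳ j)

Total≢ : ∀ {A : Set} → Rel A 0ℓ → Set
Total≢ _≺_ = ∀ i j → i ≢ j → i ≺ j ⊎ j ≺ i

least : ∀ {n} (_≺_ : Rel (Fin (suc n)) 0ℓ) → Transitive _≺_ → Total≢ _≺_ → ∃[ m ] ∀ j → m ≢ j → m ≺ j
least {zero}  _≺_ ≺-trans ≺-total = zero , λ { zero 0≢0 → contradiction refl 0≢0 }
least {suc n} _≺_ ≺-trans ≺-total
  with m , m≺ ← least (λ i j → suc i ≺ suc j) ≺-trans (λ i j i≢j → ≺-total _ _ (i≢j ∘ Fin.suc-injective))
  with ≺-total zero (suc m) (λ ())
... | inj₂ m≺0 = suc m , λ { zero _ → m≺0 ; (suc j) m≢j → m≺ j (m≢j ∘ cong suc) }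
... | inj₁ 0≺m = zero , λ { zero 0≢0 → contradiction refl 0≢0 ; (suc j) _ → 0≺suc j }
  where
  0≺suc : ∀ j → zero ≺ suc j
  0≺suc j with m Fin.≟ j
  ... | yes refl = 0≺m
  ... | no m≢j   = ≺-trans 0≺m (m≺ j m≢j)

-- Selection sort: the least element goes to position zero, and `punchIn m` relabels the remaining
-- ones for the recursive call.
sorting-permutation : ∀ {n} (_≺_ : Rel (Fin n) 0ℓ) → Transitive _≺_ → Total≢ _≺_ → ∃[ σ ] Sorts _≺_ σ
sorting-permutation {zero}  _≺_ ≺-trans ≺-total = Perm.id , λ { {()} }
sorting-permutation {suc n} _≺_ ≺-trans ≺-total
  with m , m≺ ← least _≺_ ≺-trans ≺-total
  with σ , σ-sorts ← sorting-permutation (λ i j → punchIn m i ≺ punchIn m j) ≺-trans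
                       (λ i j i≢j → ≺-total _ _ (i≢j ∘ Fin.punchIn-injective m i j))
  = Perm.insert zero m σ , sorts
  where
  sorts : Sorts _≺_ (Perm.insert zero m σ)
  sorts {zero}  {suc j} _         = m≺ _ (Fin.punchInᵢ≢i m (σ ⟨$⟩ʳ j) ∘ sym)
  sorts {suc i} {suc j} (s≤s i<j) = σ-sorts i<j

strictly-monotone⇒inflationary : ∀ {n} (ρ : Fin n → Fin n) → (∀ {i j} → i Fin.< j → ρ i Fin.< ρ j) →
                                 ∀ i → i Fin.≤ ρ i
strictly-monotone⇒inflationary {suc n} ρ ρ-mono = <-weakInduction (λ i → i Fin.≤ ρ i) z≤n
  (λ i i≤ρi → ℕ.≤-<-trans (subst (_≤ toℕ (ρ (inject₁ i))) (Fin.toℕ-inject₁ i) i≤ρi)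
    (ρ-mono (s≤s (ℕ.≤-reflexive (Fin.toℕ-inject₁ i)))))

module _ {n} {_≺_ : Rel (Fin n) 0ℓ} (≺-irrefl : Irreflexive _≡_ _≺_) (≺-trans : Transitive _≺_) where

  private
    ratio-monotone : ∀ {σ τ} → Sorts _≺_ σ → Sorts _≺_ τ →
                     ∀ {i j} → i Fin.< j → (τ ⟨$⟩ˡ (σ ⟨$⟩ʳ i)) Fin.< (τ ⟨$⟩ˡ (σ ⟨$⟩ʳ j))
    ratio-monotone {σ} {τ} σ-sorts τ-sorts {i} {j} i<j
      with Fin.<-cmp (τ ⟨$⟩ˡ (σ ⟨$⟩ʳ i)) (τ ⟨$⟩ˡ (σ ⟨$⟩ʳ j))
    ... | tri< i<j′ _ _ = i<j′
    ... | tri≈ _ i≡j′ _ = contradiction (σ-sorts i<j)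
      (≺-irrefl (trans (sym (Perm.inverseʳ τ)) (trans (cong (τ ⟨$⟩ʳ_) i≡j′) (Perm.inverseʳ τ))))
    ... | tri> _ _ j<i′ = contradiction
      (≺-trans (σ-sorts i<j) (subst₂ _≺_ (Perm.inverseʳ τ) (Perm.inverseʳ τ) (τ-sorts j<i′)))
      (≺-irrefl refl)

  -- The ratio τ⁻¹σ is strictly monotone, hence moves no index down. The same holds for its inverse
  -- σ⁻¹τ, and the two inequalities leave only the identity.
  sorting-permutation-unique : ∀ {σ τ} → Sorts _≺_ σ → Sorts _≺_ τ → σ Perm.≈ τ
  sorting-permutation-unique {σ} {τ} σ-sorts τ-sorts i = begin
    σ ⟨$⟩ʳ i                          ≡⟨ Perm.inverseʳ τ ⟨
    τ ⟨$⟩ʳ (τ ⟨$⟩ˡ (σ ⟨$⟩ʳ i))        ≡⟨ cong (τ ⟨$⟩ʳ_) (Fin.≤-antisym ρi≤i i≤ρi) ⟩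
    τ ⟨$⟩ʳ i                          ∎
    where
    open ≡-Reasoning
    ρi = τ ⟨$⟩ˡ (σ ⟨$⟩ʳ i)
    i≤ρi : i Fin.≤ ρi
    i≤ρi = strictly-monotone⇒inflationary _ (ratio-monotone {σ} {τ} σ-sorts τ-sorts) i
    ρi≤i : ρi Fin.≤ i
    ρi≤i = subst (ρi Fin.≤_) (trans (cong (σ ⟨$⟩ˡ_) (Perm.inverseʳ τ)) (Perm.inverseˡ σ))
      (strictly-monotone⇒inflationary _ (ratio-monotone {τ} {σ} τ-sorts σ-sorts) ρi)

module _ {n} (f : Fin n → ℕ) where

  -- Equal values keep their order, so that no descent separates them.
  infix 4 _≺_
  _≺_ : Rel (Fin n) 0ℓ
  i ≺ j = f j < f i ⊎ (f i ≡ f j × i Fin.< j)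

  ≺-trans : Transitive _≺_
  ≺-trans (inj₁ fj<fi)         (inj₁ fk<fj)         = inj₁ (ℕ.<-trans fk<fj fj<fi)
  ≺-trans (inj₁ fj<fi)         (inj₂ (fj≡fk , _))   = inj₁ (ℕ.≤-<-trans (ℕ.≤-reflexive (sym fj≡fk)) fj<fi)
  ≺-trans (inj₂ (fi≡fj , _))   (inj₁ fk<fj)         = inj₁ (ℕ.<-≤-trans fk<fj (ℕ.≤-reflexive (sym fi≡fj)))
  ≺-trans (inj₂ (fi≡fj , i<j)) (inj₂ (fj≡fk , j<k)) = inj₂ (trans fi≡fj fj≡fk , ℕ.<-trans i<j j<k)

  ≺-irrefl : Irreflexive _≡_ _≺_
  ≺-irrefl refl (inj₁ fi<fi)     = ℕ.<-irrefl refl fi<fi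
  ≺-irrefl refl (inj₂ (_ , i<i)) = ℕ.<-irrefl refl i<i

  ≺-total : Total≢ _≺_
  ≺-total i j i≢j with ℕ.<-cmp (f i) (f j) | Fin.<-cmp i j
  ... | tri< fi<fj _ _ | _            = inj₂ (inj₁ fi<fj)
  ... | tri> _ _ fj<fi | _            = inj₁ (inj₁ fj<fi)
  ... | tri≈ _ fi≡fj _ | tri< i<j _ _ = inj₁ (inj₂ (fi≡fj , i<j))
  ... | tri≈ _ fi≡fj _ | tri≈ _ i≡j _ = contradiction i≡j i≢j
  ... | tri≈ _ fi≡fj _ | tri> _ _ j<i = inj₂ (inj₂ (sym fi≡fj , j<i))

  ≺⇒≥ : ∀ {i j} → i ≺ j → f j ≤ f i
  ≺⇒≥ = [ ℕ.<⇒≤ , (λ (fi≡fj , _) → ℕ.≤-reflexive (sym fi≡fj)) ]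

-- Residues

module Mod {r : ℕ} .{{_ : NonZero r}} where

  +-cong-% : ∀ {a a′ b b′} → a % r ≡ a′ % r → b % r ≡ b′ % r → (a + b) % r ≡ (a′ + b′) % r
  +-cong-% {a} {a′} {b} {b′} a≡ b≡ = begin
    (a + b) % r             ≡⟨ %-distribˡ-+ a b r ⟩
    (a % r + b % r) % r     ≡⟨ cong₂ (λ x y → (x + y) % r) a≡ b≡ ⟩
    (a′ % r + b′ % r) % r   ≡⟨ %-distribˡ-+ a′ b′ r ⟨
    (a′ + b′) % r           ∎
    where open ≡-Reasoning

  +-cancelʳ-% : ∀ a b c → (a + c) % r ≡ (b + c) % r → a % r ≡ b % r
  +-cancelʳ-% a b c eq = begin
    a % r                        ≡⟨ complement a ⟨
    (a + c + c * pred r) % r     ≡⟨ +-cong-% eq refl ⟩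
    (b + c + c * pred r) % r     ≡⟨ complement b ⟩
    b % r                        ∎
    where
    open ≡-Reasoning
    -- `c * pred r` stands for -c modulo `r`, which keeps the cancellation inside ℕ.
    complement : ∀ x → (x + c + c * pred r) % r ≡ x % r
    complement x = begin
      (x + c + c * pred r) % r     ≡⟨ cong (_% r) (ℕ.+-assoc x c _) ⟩
      (x + (c + c * pred r)) % r   ≡⟨ cong (λ y → (x + y) % r) (ℕ.*-suc c (pred r)) ⟨
      (x + c * suc (pred r)) % r   ≡⟨ cong (λ y → (x + c * y) % r) (ℕ.suc-pred r) ⟩
      (x + c * r) % r              ≡⟨ [m+kn]%n≡m%n x c r ⟩
      x % r                        ∎

  sum-cong-% : ∀ {n} (f g : Fin n → ℕ) → (∀ i → f i % r ≡ g i % r) → sumℕ f % r ≡ sumℕ g % r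
  sum-cong-% {zero}  f g f≡g = refl
  sum-cong-% {suc n} f g f≡g = +-cong-% {f zero} (f≡g zero) (sum-cong-% (f ∘ suc) (g ∘ suc) (f≡g ∘ suc))

  %-cong-∣ : ∀ {m a b} .{{_ : NonZero m}} → m ∣ r → a % r ≡ b % r → a % m ≡ b % m
  %-cong-∣ {m} {a} {b} m∣r a≡b = begin
    a % m       ≡⟨ m∣n⇒o%n%m≡o%m m r a m∣r ⟨
    a % r % m   ≡⟨ cong (_% m) a≡b ⟩
    b % r % m   ≡⟨ m∣n⇒o%n%m≡o%m m r b m∣r ⟩
    b % m       ∎
    where open ≡-Reasoning

  ∣-resp-% : ∀ {m a b} .{{_ : NonZero m}} → m ∣ r → a % r ≡ b % r → m ∣ a → m ∣ b
  ∣-resp-% {m} {a} {b} m∣r a≡b m∣a =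
    m%n≡0⇒n∣m b m (trans (sym (%-cong-∣ m∣r a≡b)) (n∣m⇒m%n≡0 a m m∣a))

  -- A negative multiple of `r` is moved to the other side, so that both cases end in adding a
  -- multiple of `r` to a natural number.
  ≡⇒%≡ : ∀ {a b} (q : ℤ) → pos a ≡ pos b +ℤ q *ℤ pos r → a % r ≡ b % r
  ≡⇒%≡ {a} {b} (pos q) eq = trans
    (cong (_% r) (ℤ.+-injective (trans eq (cong (pos b +ℤ_) (sym (ℤ.pos-* q r))))))
    ([m+kn]%n≡m%n b q r)
  ≡⇒%≡ {a} {b} -[1+ q ] eq = sym (trans (cong (_% r) (ℤ.+-injective (begin
    pos b                              ≡⟨ ℤ.+-identityʳ _ ⟨
    pos b +ℤ 0ℤ                        ≡⟨ cong (pos b +ℤ_) (ℤ.+-inverseˡ qr) ⟨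
    pos b +ℤ (-ℤ qr +ℤ qr)             ≡⟨ ℤ.+-assoc (pos b) (-ℤ qr) qr ⟨
    pos b +ℤ -ℤ qr +ℤ qr               ≡⟨ cong (λ x → pos b +ℤ x +ℤ qr) (ℤ.neg-distribˡ-* (pos (suc q)) (pos r)) ⟩
    pos b +ℤ -[1+ q ] *ℤ pos r +ℤ qr   ≡⟨ cong (_+ℤ qr) eq ⟨
    pos a +ℤ qr                        ≡⟨ cong (pos a +ℤ_) (ℤ.pos-* (suc q) r) ⟨
    pos (a + suc q * r)                ∎))) ([m+kn]%n≡m%n a (suc q) r))
    where
    open ≡-Reasoning
    qr = pos (suc q) *ℤ pos r

  -- Trades the integer difference in `kᶜ` for a congruence between natural numbers, the form in
  -- which colours are compared with letters.
  R-difference : ∀ c d → (R r (pos c -ℤ pos d) + d) % r ≡ c % r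
  R-difference c d = sym (≡⇒%≡ (δ /ℕ r) (begin
    pos c                                      ≡⟨ //-rightDividesˡ (pos d) (pos c) ⟨
    δ +ℤ pos d                                 ≡⟨ cong (_+ℤ pos d) (a≡a%ℕn+[a/ℕn]*n δ r) ⟩
    pos (δ %ℕ r) +ℤ δ /ℕ r *ℤ pos r +ℤ pos d   ≡⟨ xy∙z≈xz∙y (pos (δ %ℕ r)) (δ /ℕ r *ℤ pos r) (pos d) ⟩
    pos (δ %ℕ r + d) +ℤ δ /ℕ r *ℤ pos r        ∎))
    where
    open ≡-Reasoning
    open GroupProperties (CommutativeRing.+-group ℤ.+-*-commutativeRing) using (//-rightDividesˡ)
    open CommutativeSemigroupProperties ℤ.+-commutativeSemigroup using (xy∙z≈xz∙y)
    δ = pos c -ℤ pos d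

  R<r : ∀ z → R r z < r
  R<r z = n%ℕd<d z r

  R-zero : ∀ (c : Fin r) → R r (pos (toℕ c) -ℤ pos (toℕ c)) ≡ 0
  R-zero c = trans (cong (R r) (ℤ.+-inverseʳ (pos (toℕ c)))) (m<n⇒m%n≡m (>-nonZero⁻¹ r))

  R-nonZero : ∀ (c d : Fin r) → R r (pos (toℕ c) -ℤ pos (toℕ d)) ≡ 0 → c ≡ d
  R-nonZero c d R≡0 = Fin.toℕ-injective (begin
    toℕ c                                         ≡⟨ toℕ-% r 0 c ⟨
    toℕ c % r                                     ≡⟨ R-difference (toℕ c) (toℕ d) ⟨
    (R r (pos (toℕ c) -ℤ pos (toℕ d)) + toℕ d) % r ≡⟨ cong (λ x → (x + toℕ d) % r) R≡0 ⟩
    toℕ d % r                                     ≡⟨ toℕ-% r 0 d ⟩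
    toℕ d                                         ∎)
    where open ≡-Reasoning

-- Sequences with given differences

staircase : ∀ {n} → (Fin n → ℕ) → ℕ → Fin (suc n) → ℕ
staircase {zero}  d e _       = e
staircase {suc n} d e zero    = d zero + staircase (d ∘ suc) e zero
staircase {suc n} d e (suc i) = staircase (d ∘ suc) e i

staircase-step : ∀ {n} (d : Fin n → ℕ) e i → staircase d e (inject₁ i) ≡ d i + staircase d e (suc i)
staircase-step {suc n}       d e zero    = refl
staircase-step {suc (suc n)} d e (suc i) = staircase-step (d ∘ suc) e i

staircase-last : ∀ {n} (d : Fin n → ℕ) e → staircase d e (fromℕ n) ≡ e
staircase-last {zero}  d e = refl
staircase-last {suc n} d e = staircase-last (d ∘ suc) e

-- Identities between staircases reduce to this one induction: only the steps and the last entry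
-- have to be compared.
staircase-unique : ∀ {n} {d : Fin n → ℕ} {e} (γ : Fin (suc n) → ℕ) →
                   (∀ i → γ (inject₁ i) ≡ d i + γ (suc i)) → γ (fromℕ n) ≡ e → γ ≗ staircase d e
staircase-unique {zero}      γ step last zero    = last
staircase-unique {suc n} {d} γ step last zero    =
  trans (step zero) (cong (d zero +_) (staircase-unique (γ ∘ suc) (step ∘ suc) last zero))
staircase-unique {suc n}     γ step last (suc i) = staircase-unique (γ ∘ suc) (step ∘ suc) last i

staircase-cong : ∀ {n} {d d′ : Fin n → ℕ} {e e′} → d ≗ d′ → e ≡ e′ → staircase d e ≗ staircase d′ e′
staircase-cong {d = d} {e = e} d≗ e≡ = staircase-unique (staircase d e)
  (λ i → trans (staircase-step d e i) (cong (_+ staircase d e (suc i)) (d≗ i)))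
  (trans (staircase-last d e) e≡)

staircase-+ : ∀ {n} (d d′ : Fin n → ℕ) e e′ i →
              staircase d e i + staircase d′ e′ i ≡ staircase (λ j → d j + d′ j) (e + e′) i
staircase-+ d d′ e e′ = staircase-unique (λ i → staircase d e i + staircase d′ e′ i)
  (λ i → trans (cong₂ _+_ (staircase-step d e i) (staircase-step d′ e′ i)) (interchange (d i) _ (d′ i) _))
  (cong₂ _+_ (staircase-last d e) (staircase-last d′ e′))
  where open CommutativeSemigroupProperties ℕ.+-commutativeSemigroup using (interchange)

staircase-* : ∀ {n} r (d : Fin n → ℕ) e i → r * staircase d e i ≡ staircase (λ j → r * d j) (r * e) i
staircase-* r d e = staircase-unique (λ i → r * staircase d e i)
  (λ i → trans (cong (r *_) (staircase-step d e i)) (ℕ.*-distribˡ-+ r _ _))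
  (cong (r *_) (staircase-last d e))

staircase-zero : ∀ {n} (d : Fin n → ℕ) e → staircase d e zero ≡ sumℕ d + e
staircase-zero {zero}  d e = refl
staircase-zero {suc n} d e = trans (cong (d zero +_) (staircase-zero (d ∘ suc) e)) (sym (ℕ.+-assoc (d zero) _ e))

staircase≤zero : ∀ {n} (d : Fin n → ℕ) e i → staircase d e i ≤ staircase d e zero
staircase≤zero {zero}  d e zero    = ℕ.≤-refl
staircase≤zero {suc n} d e zero    = ℕ.≤-refl
staircase≤zero {suc n} d e (suc i) = ℕ.≤-trans (staircase≤zero (d ∘ suc) e i) (ℕ.m≤n+m _ (d zero))

-- Summation by parts: the drop `d i` lies below the entries `0, …, i`, and `e` below all of them.
-- The factors `suc (toℕ i)` give the q-exponents r, 2r, ... of the denominator, and `suc n` gives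
-- that of its last factor.
sum-staircase : ∀ {n} (d : Fin n → ℕ) e →
                sumℕ (staircase d e) ≡ sumℕ (λ i → suc (toℕ i) * d i) + suc n * e
sum-staircase {zero}  d e = refl
sum-staircase {suc n} d e = begin
  d zero + staircase (d ∘ suc) e zero + sumℕ (staircase (d ∘ suc) e)
    ≡⟨ cong₂ (λ x y → d zero + x + y) (staircase-zero (d ∘ suc) e) (sum-staircase (d ∘ suc) e) ⟩
  d zero + (sumℕ (d ∘ suc) + e) + (sumℕ (λ i → suc (toℕ i) * d (suc i)) + suc n * e)
    ≡⟨ rearrange (d zero) (sumℕ (d ∘ suc)) e _ (suc n * e) ⟩
  1 * d zero + (sumℕ (d ∘ suc) + sumℕ (λ i → suc (toℕ i) * d (suc i))) + suc (suc n) * e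
    ≡⟨ cong (λ x → 1 * d zero + x + suc (suc n) * e)
         (∑-distrib-+ (d ∘ suc) (λ i → suc (toℕ i) * d (suc i))) ⟨
  1 * d zero + sumℕ (λ i → suc (suc (toℕ i)) * d (suc i)) + suc (suc n) * e ∎
  where
  open ≡-Reasoning
  rearrange : ∀ a b c x y → a + (b + c) + (x + y) ≡ 1 * a + (b + x) + (c + y)
  rearrange = solve-∀

staircase-injective : ∀ {n} {d d′ : Fin n → ℕ} {e e′} → staircase d e ≗ staircase d′ e′ → d ≗ d′ × e ≡ e′
staircase-injective {n} {d} {d′} {e} {e′} eq =
  (λ i → ℕ.+-cancelʳ-≡ (staircase d e (suc i)) (d i) (d′ i) (begin
    d i + staircase d e (suc i)      ≡⟨ staircase-step d e i ⟨
    staircase d e (inject₁ i)        ≡⟨ eq (inject₁ i) ⟩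
    staircase d′ e′ (inject₁ i)      ≡⟨ staircase-step d′ e′ i ⟩
    d′ i + staircase d′ e′ (suc i)   ≡⟨ cong (d′ i +_) (eq (suc i)) ⟨
    d′ i + staircase d e (suc i)     ∎)) ,
  trans (sym (staircase-last d e)) (trans (eq (fromℕ n)) (staircase-last d′ e′))
  where open ≡-Reasoning

⌜_⌝ : Bool → ℕ
⌜ b ⌝ = if b then 1 else 0

length-filter-tabulate : ∀ {A : Set} {P : A → Set} (P? : Decidable P) {n} (f : Fin n → A) →
                         List.length (List.filter P? (List.tabulate f)) ≡ sumℕ (λ i → ⌜ does (P? (f i)) ⌝)
length-filter-tabulate P? {zero}  f = refl
length-filter-tabulate P? {suc n} f with does (P? (f zero))
... | true  = cong suc (length-filter-tabulate P? (f ∘ suc))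
... | false = length-filter-tabulate P? (f ∘ suc)

-- Brings h_i into the shape that `kᶜ` has, built up from the last position, so that the two can be
-- added step by step.
tail-count : ∀ {n} (b : Fin (suc n) → Bool) i →
             sumℕ (λ j → ⌜ does (i Fin.≤? j) ∧ b j ⌝) ≡ staircase (⌜_⌝ ∘ b ∘ inject₁) ⌜ b (fromℕ n) ⌝ i
tail-count {zero}  b zero    = ℕ.+-identityʳ _
tail-count {suc n} b zero    = cong (⌜ b zero ⌝ +_) (tail-count (b ∘ suc) zero)
tail-count {suc n} b (suc i) = trans
  (sum-cong-≗ λ j → cong (λ x → ⌜ x ∧ b (suc j) ⌝) (suc-≤? i j))
  (tail-count (b ∘ suc) i)
  where
  suc-≤? : ∀ (i j : Fin (suc n)) → does (suc i Fin.≤? suc j) ≡ does (i Fin.≤? j)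
  suc-≤? zero    j = refl
  suc-≤? (suc i) j = refl

-- Coloured permutations and words

module Decomposition (r s n : ℕ) .{{_ : NonZero r}} .{{_ : NonZero s}} (s∣r : s ∣ r) where

  open Mod {r}
  private module Stat = Statistics {r} {suc n} s s∣r
  open Stat using (HDes; HDes?; lam; fmaj; des)
  open MonoidMult (Group.monoid (G[r,n] r (suc n))) using () renaming (_×_ to _·_)
  open CyclicCosets (G[r,n] r (suc n)) (generator r (suc n) s)

  m : ℕ
  m = r / s

  instance
    m≢0 : NonZero m
    m≢0 = >-nonZero (m≥n⇒m/n>0 (∣⇒≤ s∣r))

  m*s≡r : m * s ≡ r
  m*s≡r = m/n*n≡m s∣r

  colourStep : ∀ {n} → (Fin (suc n) → Fin r) → Fin n → ℕ
  colourStep c i = R r (pos (toℕ (c (inject₁ i))) -ℤ pos (toℕ (c (suc i))))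

  kᶜ-staircase : ∀ {n} (c : Fin (suc n) → Fin r) →
                 Stat.kᶜ c ≗ staircase (colourStep c) (toℕ (c (fromℕ n)) % m)
  kᶜ-staircase {zero}  c zero    = refl
  kᶜ-staircase {suc n} c zero    =
    trans (ℕ.+-comm _ (colourStep c zero)) (cong (colourStep c zero +_) (kᶜ-staircase (c ∘ suc) zero))
  kᶜ-staircase {suc n} c (suc i) = kᶜ-staircase (c ∘ suc) i

  module _ (g : ColouredPermutation r (suc n)) where

    private
      σ = perm g ⟨$⟩ʳ_
      c = colour g

    descent : Fin n → Bool
    descent i = does (HDes? g (inject₁ i))

    HDes-step : ∀ i → HDes g (inject₁ i) → c (inject₁ i) ≡ c (suc i) × σ (suc i) Fin.< σ (inject₁ i)
    HDes-step i (j , j≡ , ci≡cj , σj<σi)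
      with refl ← Fin.toℕ-injective {i = j} {suc i} (trans j≡ (cong suc (Fin.toℕ-inject₁ i))) = ci≡cj , σj<σi

    HDes-step⁻¹ : ∀ i → c (inject₁ i) ≡ c (suc i) → σ (suc i) Fin.< σ (inject₁ i) → HDes g (inject₁ i)
    HDes-step⁻¹ i c≡ σ< = suc i , cong suc (sym (Fin.toℕ-inject₁ i)) , c≡ , σ<

    ¬HDes-last : ¬ HDes g (fromℕ n)
    ¬HDes-last (j , j≡ , _) = ℕ.<-irrefl (trans j≡ (cong suc (Fin.toℕ-fromℕ n))) (Fin.toℕ<n j)

    lamStep : Fin n → ℕ
    lamStep i = r * ⌜ descent i ⌝ + colourStep c i

    lamLast : ℕ
    lamLast = toℕ (c (fromℕ n)) % m

    -- Both summands of λ are staircases, so their drops add. The last position is never a descent,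
    -- so r h contributes 0 there and the last entry comes from k alone.
    lam-staircase : lam g ≗ staircase lamStep lamLast
    lam-staircase i = begin
      r * Stat.h g i + Stat.k g i
        ≡⟨ cong₂ (λ x y → r * x + y) h-staircase (kᶜ-staircase c i) ⟩
      r * staircase (⌜_⌝ ∘ descent) 0 i + staircase (colourStep c) lamLast i
        ≡⟨ cong (_+ staircase (colourStep c) lamLast i) (staircase-* r (⌜_⌝ ∘ descent) 0 i) ⟩
      staircase (λ j → r * ⌜ descent j ⌝) (r * 0) i + staircase (colourStep c) lamLast i
        ≡⟨ staircase-+ _ _ (r * 0) lamLast i ⟩
      staircase lamStep (r * 0 + lamLast) i
        ≡⟨ staircase-cong (λ _ → refl) (cong (_+ lamLast) (ℕ.*-zeroʳ r)) i ⟩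
      staircase lamStep lamLast i ∎
      where
      open ≡-Reasoning
      h-staircase : Stat.h g i ≡ staircase (⌜_⌝ ∘ descent) 0 i
      h-staircase = begin
        Stat.h g i
          ≡⟨ length-filter-tabulate (λ j → (i Fin.≤? j) ×-dec HDes? g j) (λ j → j) ⟩
        sumℕ (λ j → ⌜ does (i Fin.≤? j) ∧ does (HDes? g j) ⌝)
          ≡⟨ tail-count (λ j → does (HDes? g j)) i ⟩
        staircase (⌜_⌝ ∘ descent) ⌜ does (HDes? g (fromℕ n)) ⌝ i
          ≡⟨ staircase-cong (λ _ → refl) (cong ⌜_⌝ (dec-false (HDes? g (fromℕ n)) ¬HDes-last)) i ⟩
        staircase (⌜_⌝ ∘ descent) 0 i ∎

  -- The shift κ accounts for the choice of g in its coset: the generator adds m to each colour.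
  record Compatible (g : ColouredPermutation r (suc n)) (f : Fin (suc n) → ℕ) : Set where
    field
      sorts   : Sorts (_≺_ f) (perm g)
      κ       : ℕ
      colours : ∀ i → f (perm g ⟨$⟩ʳ i) % r ≡ (toℕ (colour g i) + κ * m) % r

  open Compatible

  -- The drops are congruent to the colour differences, so the congruence at the last position
  -- travels upwards with the same shift `κ * m`.
  staircase-colours : ∀ {n} (c : Fin (suc n) → Fin r) (d : Fin n → ℕ) e κ →
    (∀ i → d i % r ≡ colourStep c i % r) → e % r ≡ (toℕ (c (fromℕ n)) + κ * m) % r →
    ∀ i → staircase d e i % r ≡ (toℕ (c i) + κ * m) % r
  staircase-colours {zero}  c d e κ d≡ e≡ zero    = e≡
  staircase-colours {suc n} c d e κ d≡ e≡ (suc i) = staircase-colours (c ∘ suc) (d ∘ suc) e κ (d≡ ∘ suc) e≡ i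
  staircase-colours {suc n} c d e κ d≡ e≡ zero    = begin
    (d zero + staircase (d ∘ suc) e zero) % r
      ≡⟨ +-cong-% (d≡ zero) (staircase-colours (c ∘ suc) (d ∘ suc) e κ (d≡ ∘ suc) e≡ zero) ⟩
    (δ + (c₁ + κ * m)) % r
      ≡⟨ cong (_% r) (ℕ.+-assoc δ c₁ (κ * m)) ⟨
    (δ + c₁ + κ * m) % r
      ≡⟨ +-cong-% (R-difference (toℕ (c zero)) c₁) refl ⟩
    (toℕ (c zero) + κ * m) % r ∎
    where
    open ≡-Reasoning
    δ = R r (pos (toℕ (c zero)) -ℤ pos (toℕ (c (suc zero))))
    c₁ = toℕ (c (suc zero))

  -- At a descent x - y is a positive multiple of r, so one r can be taken out of the quotient.
  quotient : ∀ {H : Set} (H? : Dec H) x y ρ → ρ < r → y ≤ x → x % r ≡ (ρ + y) % r →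
             (H → ρ ≡ 0 × y < x) → ∃[ a ] x ≡ r * ⌜ does H? ⌝ + ρ + r * a + y
  quotient {H} H? x y ρ ρ<r y≤x x≡ descends with (x ∸ y) / r in q≡ | x∸y≡
    where
    x∸y≡ : x ∸ y ≡ ρ + (x ∸ y) / r * r
    x∸y≡ = trans (m≡m%n+[m/n]*n (x ∸ y) r) (cong (_+ (x ∸ y) / r * r)
      (trans (+-cancelʳ-% (x ∸ y) ρ y (trans (cong (_% r) (ℕ.m∸n+n≡m y≤x)) x≡)) (m<n⇒m%n≡m ρ<r)))
  ... | q | x∸y≡ with H?
  ...   | no _ = q , trans (sym (ℕ.m∸n+n≡m y≤x)) (trans (cong (_+ y) x∸y≡) (rearrange r ρ q y))
    where
    rearrange : ∀ r ρ q y → ρ + q * r + y ≡ r * 0 + ρ + r * q + y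
    rearrange = solve-∀
  ...   | yes h with refl , y<x ← descends h with q
  ...     | zero  = contradiction (subst (0 <_) x∸y≡ (ℕ.m<n⇒0<n∸m y<x)) (ℕ.<-irrefl refl)
  ...     | suc q = q , trans (sym (ℕ.m∸n+n≡m y≤x)) (trans (cong (_+ y) x∸y≡) (rearrange r q y))
    where
    rearrange : ∀ r q y → 0 + (r + q * r) + y ≡ r * 1 + 0 + r * q + y
    rearrange = solve-∀

  -- Written as a single staircase so that `a` can be read off from the drops and `h` from the last
  -- entry; `decomposed-split` separates λ from the rest.
  decomposed : ColouredPermutation r (suc n) → Vec ℕ n → ℕ → Fin (suc n) → ℕ
  decomposed g a h = staircase (λ i → lamStep g i + r * lookup a i) (lamLast g + m * h)

  module _ (g : ColouredPermutation r (suc n)) (f : Fin (suc n) → ℕ) where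

    private
      σ = perm g ⟨$⟩ʳ_
      c = colour g
      δ = colourStep c
      H? : ∀ i → Dec (HDes g (inject₁ i))
      H? i = HDes? g (inject₁ i)

      inject₁<suc : ∀ (i : Fin n) → inject₁ i Fin.< suc i
      inject₁<suc i = s≤s (ℕ.≤-reflexive (Fin.toℕ-inject₁ i))

    compatible⇒decomposed : Compatible g f → ∃[ a ] ∃[ h ] f ∘ σ ≗ decomposed g a h
    compatible⇒decomposed f-compatible = tabulate (proj₁ ∘ step) , f (σ (fromℕ n)) / m ,
      staircase-unique (f ∘ σ)
        (λ i → trans (proj₂ (step i))
          (cong (λ a → lamStep g i + r * a + f (σ (suc i))) (sym (lookup∘tabulate (proj₁ ∘ step) i))))
        last
      where
      κ′ = κ f-compatible

      step : ∀ i → ∃[ a ] f (σ (inject₁ i)) ≡ lamStep g i + r * a + f (σ (suc i))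
      step i = quotient (H? i) (f (σ (inject₁ i))) (f (σ (suc i))) (δ i)
        (R<r (pos (toℕ (c (inject₁ i))) -ℤ pos (toℕ (c (suc i)))))
        (≺⇒≥ f (sorts f-compatible (inject₁<suc i)))
        (begin
          f (σ (inject₁ i)) % r                             ≡⟨ colours f-compatible (inject₁ i) ⟩
          (toℕ (c (inject₁ i)) + κ′ * m) % r                ≡⟨ +-cong-% (R-difference (toℕ (c (inject₁ i))) (toℕ (c (suc i)))) refl ⟨
          (δ i + toℕ (c (suc i)) + κ′ * m) % r              ≡⟨ cong (_% r) (ℕ.+-assoc (δ i) _ _) ⟩
          (δ i + (toℕ (c (suc i)) + κ′ * m)) % r            ≡⟨ +-cong-% {δ i} refl (colours f-compatible (suc i)) ⟨
          (δ i + f (σ (suc i))) % r                         ∎)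
        descends
        where
        open ≡-Reasoning
        -- Equal letters keep their order under a sorting permutation, so where the permutation
        -- descends the letters must drop strictly.
        descends : HDes g (inject₁ i) → δ i ≡ 0 × f (σ (suc i)) < f (σ (inject₁ i))
        descends H with c≡ , σ< ← HDes-step g i H =
          trans (cong (λ x → R r (pos (toℕ (c (inject₁ i))) -ℤ pos (toℕ x))) (sym c≡)) (R-zero (c (inject₁ i))) ,
          [ (λ f< → f<) , (λ (_ , <σ) → contradiction <σ (ℕ.<-asym σ<)) ] (sorts f-compatible (inject₁<suc i))

      last : f (σ (fromℕ n)) ≡ lamLast g + m * (f (σ (fromℕ n)) / m)
      last = begin
        f (σ (fromℕ n))
          ≡⟨ m≡m%n+[m/n]*n _ m ⟩
        f (σ (fromℕ n)) % m + f (σ (fromℕ n)) / m * m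
          -- Modulo `m`, which divides `r`, the shift `κ′ * m` disappears.
          ≡⟨ cong₂ _+_ (trans (%-cong-∣ (divides s (trans (sym m*s≡r) (ℕ.*-comm m s))) (colours f-compatible (fromℕ n)))
                         ([m+kn]%n≡m%n (toℕ (c (fromℕ n))) κ′ m))
                       (ℕ.*-comm _ m) ⟩
        toℕ (c (fromℕ n)) % m + m * (f (σ (fromℕ n)) / m) ∎
        where open ≡-Reasoning

    decomposed⇒compatible : ∀ a h → f ∘ σ ≗ decomposed g a h → Compatible g f
    decomposed⇒compatible a h f≗ = record
      { sorts   = λ {i} {j} → chain (λ {i} {j} {k} → ≺-trans f {i} {j} {k}) σ ≺-step {i} {j}
      -- pred s stands for -1, since s * m = r.
      ; κ       = h + q * pred s
      ; colours = λ i → trans (cong (_% r) (f≗ i)) (staircase-colours c _ _ (h + q * pred s) d≡ e≡ i)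
      }
      where
      open ≡-Reasoning
      d = λ i → lamStep g i + r * lookup a i
      q = toℕ (c (fromℕ n)) / m
      ρ = toℕ (c (fromℕ n)) % m

      d≡ : ∀ i → d i % r ≡ δ i % r
      d≡ i = trans (cong (_% r) (rearrange r ⌜ does (H? i) ⌝ (δ i) (lookup a i)))
        ([m+kn]%n≡m%n (δ i) (⌜ does (H? i) ⌝ + lookup a i) r)
        where
        rearrange : ∀ r x δ a → r * x + δ + r * a ≡ δ + (x + a) * r
        rearrange = solve-∀

      e≡ : (ρ + m * h) % r ≡ (toℕ (c (fromℕ n)) + (h + q * pred s) * m) % r
      e≡ = sym (begin
        (toℕ (c (fromℕ n)) + (h + q * pred s) * m) % r
          ≡⟨ cong (λ x → (x + (h + q * pred s) * m) % r) (m≡m%n+[m/n]*n _ m) ⟩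
        (ρ + q * m + (h + q * pred s) * m) % r
          ≡⟨ cong (_% r) (rearrange ρ q m h (pred s)) ⟩
        (ρ + m * h + q * (m * suc (pred s))) % r
          ≡⟨ cong (λ x → (ρ + m * h + q * x) % r) (trans (cong (m *_) (ℕ.suc-pred s)) m*s≡r) ⟩
        (ρ + m * h + q * r) % r
          ≡⟨ [m+kn]%n≡m%n (ρ + m * h) q r ⟩
        (ρ + m * h) % r ∎)
        where
        rearrange : ∀ ρ q m h s → ρ + q * m + (h + q * s) * m ≡ ρ + m * h + q * (m * suc s)
        rearrange = solve-∀

      f-step : ∀ i → f (σ (inject₁ i)) ≡ d i + f (σ (suc i))
      f-step i = trans (f≗ (inject₁ i)) (trans (staircase-step d _ i) (cong (d i +_) (sym (f≗ (suc i)))))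

      -- If the colours agree, the position is in `HDes` and the step contains `r`; if they differ,
      -- the residue of their difference is already positive. So a tie in `f` never sits at a
      -- descent of the permutation.
      0<d : ∀ i → σ (suc i) Fin.< σ (inject₁ i) → 0 < d i
      0<d i σ< with c (inject₁ i) Fin.≟ c (suc i)
      ... | yes c≡ = ℕ.m≤n⇒m≤n+o (r * lookup a i) (ℕ.m≤n⇒m≤n+o (δ i)
        (subst (λ b → 0 < r * ⌜ b ⌝) (sym (dec-true (H? i) (HDes-step⁻¹ g i c≡ σ<)))
          (subst (0 <_) (sym (ℕ.*-identityʳ r)) (>-nonZero⁻¹ r))))
      ... | no c≢  = ℕ.m≤n⇒m≤n+o (r * lookup a i) (ℕ.m≤n⇒m≤o+n (r * ⌜ does (H? i) ⌝)
        (ℕ.n≢0⇒n>0 (c≢ ∘ R-nonZero _ _)))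

      ≺-step : ∀ i → _≺_ f (σ (inject₁ i)) (σ (suc i))
      ≺-step i with Fin.<-cmp (σ (inject₁ i)) (σ (suc i))
      ... | tri> _ _ σ< = inj₁ (subst (f (σ (suc i)) <_) (sym (f-step i)) (ℕ.+-monoˡ-≤ (f (σ (suc i))) (0<d i σ<)))
      ... | tri≈ _ σ≡ _ = contradiction (cong toℕ (trans (sym (Perm.inverseˡ (perm g)))
        (trans (cong (perm g ⟨$⟩ˡ_) σ≡) (Perm.inverseˡ (perm g))))) (ℕ.<⇒≢ (inject₁<suc i))
      ... | tri< <σ _ _ = Sum.map₂ (λ f≡ → sym f≡ , <σ)
        (ℕ.m≤n⇒m<n∨m≡n (subst (f (σ (suc i)) ≤_) (sym (f-step i)) (ℕ.m≤n+m _ (d i))))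

  module _ {g g′ : ColouredPermutation r (suc n)} {f : Fin (suc n) → ℕ} where

    open ≡-Reasoning

    -- `f` has only one sorting permutation, and it fixes the colours up to the shifts by κ₁ m and
    -- κ₂ m. So the elements differ by the power κ₂ - κ₁ of the generator, with `κ₁ * pred s` in
    -- place of -κ₁ because s m = r.
    compatible-unique : Compatible g f → Compatible g′ f → g ∼ g′
    compatible-unique g-compatible g′-compatible = k ,
      (λ i → Fin.toℕ-injective (begin
        toℕ (colour g i)
          ≡⟨ toℕ-% r n (colour g i) ⟨
        toℕ (colour g i) % r
          ≡⟨ [m+kn]%n≡m%n _ κ₁ r ⟨
        (toℕ (colour g i) + κ₁ * r) % r
          ≡⟨ cong (λ x → (toℕ (colour g i) + κ₁ * x) % r) (trans (cong (m *_) (ℕ.suc-pred s)) m*s≡r) ⟨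
        (toℕ (colour g i) + κ₁ * (m * suc (pred s))) % r
          ≡⟨ cong (_% r) (rearrange (toℕ (colour g i)) κ₁ m (pred s)) ⟩
        (toℕ (colour g i) + κ₁ * m + κ₁ * pred s * m) % r
          ≡⟨ +-cong-% (begin
               (toℕ (colour g i) + κ₁ * m) % r    ≡⟨ colours g-compatible i ⟨
               f (perm g ⟨$⟩ʳ i) % r              ≡⟨ cong (λ x → f x % r) (σ≗ i) ⟩
               f (perm g′ ⟨$⟩ʳ i) % r             ≡⟨ colours g′-compatible i ⟩
               (toℕ (colour g′ i) + κ₂ * m) % r   ∎) refl ⟩
        (toℕ (colour g′ i) + κ₂ * m + κ₁ * pred s * m) % r
          ≡⟨ cong (_% r) (rearrange′ (toℕ (colour g′ i)) κ₂ m (κ₁ * pred s)) ⟩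
        (k * m + toℕ (colour g′ i)) % r
          ≡⟨ +-cong-% {b = toℕ (colour g′ i)} (m%n%n≡m%n (k * m) r) refl ⟨
        ((k * m) % r + toℕ (colour g′ i)) % r
          ≡⟨ cong₂ (λ x j → (x + toℕ (colour g′ j)) % r) (colour-· r (suc n) s k i) (perm-· r (suc n) s k i) ⟨
        (toℕ (colour (k · generator r (suc n) s) i) + toℕ (colour g′ (perm (k · generator r (suc n) s) ⟨$⟩ʳ i))) % r
          ≡⟨ toℕ-mod r n _ ⟨
        _ ∎)) ,
      (λ i → trans (σ≗ i) (cong (perm g′ ⟨$⟩ʳ_) (sym (perm-· r (suc n) s k i))))
      where
      κ₁ = κ g-compatible
      κ₂ = κ g′-compatible
      k = κ₂ + κ₁ * pred s
      σ≗ : perm g Perm.≈ perm g′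
      σ≗ = sorting-permutation-unique (≺-irrefl f) (≺-trans f) {perm g} {perm g′} (sorts g-compatible) (sorts g′-compatible)
      rearrange : ∀ c κ m s → c + κ * (m * suc s) ≡ c + κ * m + κ * s * m
      rearrange = solve-∀
      rearrange′ : ∀ c κ m x → c + κ * m + x * m ≡ (κ + x) * m + c
      rearrange′ = solve-∀

    compatible-resp-∼ : g ∼ g′ → Compatible g f → Compatible g′ f
    compatible-resp-∼ (k , c≗ , σ≗′) g-compatible = record
      { sorts   = λ {i} {j} i<j → subst₂ (_≺_ f) (σ≗ i) (σ≗ j) (sorts g-compatible i<j)
      ; κ       = k + κ₁
      ; colours = λ i → begin
          f (perm g′ ⟨$⟩ʳ i) % r
            ≡⟨ cong (λ x → f x % r) (σ≗ i) ⟨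
          f (perm g ⟨$⟩ʳ i) % r
            ≡⟨ colours g-compatible i ⟩
          (toℕ (colour g i) + κ₁ * m) % r
            ≡⟨ +-cong-% (begin
                 toℕ (colour g i) % r
                   ≡⟨ cong (λ c → toℕ c % r) (c≗ i) ⟩
                 toℕ ((colour (k · generator r (suc n) s) i) ⊞′ (colour g′ (perm (k · generator r (suc n) s) ⟨$⟩ʳ i))) % r
                   ≡⟨ trans (toℕ-% r n _) (toℕ-mod r n _) ⟩
                 (toℕ (colour (k · generator r (suc n) s) i) + toℕ (colour g′ (perm (k · generator r (suc n) s) ⟨$⟩ʳ i))) % r
                   ≡⟨ cong₂ (λ x j → (x + toℕ (colour g′ j)) % r) (colour-· r (suc n) s k i) (perm-· r (suc n) s k i) ⟩
                 ((k * m) % r + toℕ (colour g′ i)) % r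
                   ≡⟨ +-cong-% {b = toℕ (colour g′ i)} (m%n%n≡m%n (k * m) r) refl ⟩
                 (k * m + toℕ (colour g′ i)) % r ∎) refl ⟩
          (k * m + toℕ (colour g′ i) + κ₁ * m) % r
            ≡⟨ cong (_% r) (rearrange k m (toℕ (colour g′ i)) κ₁) ⟩
          (toℕ (colour g′ i) + (k + κ₁) * m) % r ∎
      }
      where
      _⊞′_ = _⊞_ r n
      κ₁ = κ g-compatible
      σ≗ : perm g Perm.≈ perm g′
      σ≗ i = trans (σ≗′ i) (cong (perm g′ ⟨$⟩ʳ_) (perm-· r (suc n) s k i))
      rearrange : ∀ k m c κ → k * m + c + κ * m ≡ c + (k + κ) * m
      rearrange = solve-∀

  -- Divisibility of the letter sum by p

  module _ {p : ℕ} .{{_ : NonZero p}} (p∣r : p ∣ r) where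

    compatible-exists : ∀ f → p ∣ sumℕ f → ∃[ g ] inG[r,p,n] r (suc n) p g × Compatible g f
    compatible-exists f p∣f with σ , σ-sorts ← sorting-permutation (_≺_ f) (≺-trans f) (≺-total f) =
      (λ i → f (σ ⟨$⟩ʳ i) mod r) ⨾ σ ,
      ∣-resp-% p∣r
        (sum-cong-% (λ i → f (σ ⟨$⟩ʳ i)) _ (λ i → sym (trans (cong (_% r) (toℕ-mod r n _)) (m%n%n≡m%n _ r))))
        (subst (p ∣_) (sum-permute f σ) p∣f) ,
      record
        { sorts = σ-sorts
        ; κ = 0
        ; colours = λ i → sym (trans (cong (_% r) (trans (ℕ.+-identityʳ _) (toℕ-mod r n _))) (m%n%n≡m%n _ r))
        }

    -- Modulo p, the letter sum exceeds the colour sum by `suc n * (κ * m)`. Cancelling `s` from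
    -- `ps∣rn`, with r = m s, shows that p divides `suc n * m`.
    compatible⇒∣ : p * s ∣ r * suc n → ∀ {g f} → inG[r,p,n] r (suc n) p g → Compatible g f → p ∣ sumℕ f
    compatible⇒∣ ps∣rn {g} {f} g∈ g-compatible = subst (p ∣_) (sym (sum-permute f (perm g)))
      (∣-resp-% p∣r (sym (sum-cong-% _ _ (colours g-compatible)))
        (subst (p ∣_) (sym (sum-shift (toℕ ∘ colour g) (κ g-compatible * m)))
          (∣m∣n⇒∣m+n g∈ (subst (p ∣_) (rearrange (κ g-compatible) (suc n) m) (∣-trans p∣nm (n∣m*n (κ g-compatible)))))))
      where
      sum-shift : ∀ {n} (f : Fin n → ℕ) x → sumℕ (λ i → f i + x) ≡ sumℕ f + n * x
      sum-shift {zero}  f x = refl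
      sum-shift {suc n} f x = trans (cong (f zero + x +_) (sum-shift (f ∘ suc) x))
        (interchange (f zero) x _ _)
        where open CommutativeSemigroupProperties ℕ.+-commutativeSemigroup using (interchange)
      rearrange : ∀ κ n m → κ * (n * m) ≡ n * (κ * m)
      rearrange = solve-∀
      p∣nm : p ∣ suc n * m
      p∣nm = *-cancelʳ-∣ s (subst (p * s ∣_) (trans (cong (_* suc n) (sym m*s≡r)) (rearrange′ m s (suc n))) ps∣rn)
        where
        rearrange′ : ∀ m s n → m * s * n ≡ n * m * s
        rearrange′ = solve-∀

  -- Descent number and major index of a decomposition

  module _ (g : ColouredPermutation r (suc n)) where

    -- As r = m s, the floor in `des` is the ceiling of λ₁ / m. Together with `des≤` this makes
    -- `des g` the least k with λ₁ ≤ m k.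
    lam₀≤m*des : lam g zero ≤ m * des g
    lam₀≤m*des = ℕ.≮⇒≥ λ m*des<lam → ℕ.<⇒≱ (n<[1+n/r]*r (s * lam g zero + r ∸ s)) (begin
      suc (des g) * r         ≡⟨ cong (suc (des g) *_) m*s≡r ⟨
      suc (des g) * (m * s)   ≤⟨ ℕ.m+n≤o⇒m≤o∸n (suc (des g) * (m * s)) (begin
        suc (des g) * (m * s) + s         ≡⟨ rearrange m s (des g) ⟩
        s * suc (m * des g) + m * s       ≡⟨ cong (s * suc (m * des g) +_) m*s≡r ⟩
        s * suc (m * des g) + r           ≤⟨ ℕ.+-monoˡ-≤ r (ℕ.*-monoʳ-≤ s m*des<lam) ⟩
        s * lam g zero + r                ∎) ⟩
      s * lam g zero + r ∸ s  ∎)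
      where
      open ℕ.≤-Reasoning
      rearrange : ∀ m s d → m * s + d * (m * s) + s ≡ s * (1 + m * d) + m * s
      rearrange = solve-∀
      n<[1+n/r]*r : ∀ x → x < suc (x / r) * r
      n<[1+n/r]*r x = subst (_< suc (x / r) * r) (sym (m≡m%n+[m/n]*n x r)) (ℕ.+-monoˡ-< (x / r * r) (m%n<n x r))

    des≤ : ∀ k → lam g zero ≤ m * k → des g ≤ k
    des≤ k lam≤ = ℕ.≤-pred (m<n*o⇒m/o<n (begin-strict
      -- Subtracting the positive `s` (at most `r`) makes the bound strict, as the floor requires.
      s * lam g zero + r ∸ s   <⟨ ℕ.∸-monoʳ-< {s * lam g zero + r} {s} {0} (>-nonZero⁻¹ s) (ℕ.m≤n⇒m≤o+n (s * lam g zero) (∣⇒≤ s∣r)) ⟩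
      s * lam g zero + r       ≤⟨ ℕ.+-monoˡ-≤ r (ℕ.*-monoʳ-≤ s lam≤) ⟩
      s * (m * k) + r          ≡⟨ cong (λ x → s * (m * k) + x) m*s≡r ⟨
      s * (m * k) + m * s      ≡⟨ rearrange m s k ⟩
      suc k * (m * s)          ≡⟨ cong (suc k *_) m*s≡r ⟩
      suc k * r                ∎))
      where
      open ℕ.≤-Reasoning
      rearrange : ∀ m s k → s * (m * k) + m * s ≡ m * s + k * (m * s)
      rearrange = solve-∀

    decomposed-split : ∀ a h i → decomposed g a h i ≡ lam g i + staircase (λ j → r * lookup a j) (m * h) i
    decomposed-split a h i = begin
      decomposed g a h i
        ≡⟨ staircase-+ (lamStep g) (λ j → r * lookup a j) (lamLast g) (m * h) i ⟨
      staircase (lamStep g) (lamLast g) i + staircase (λ j → r * lookup a j) (m * h) i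
        ≡⟨ cong (_+ staircase (λ j → r * lookup a j) (m * h) i) (lam-staircase g i) ⟨
      lam g i + staircase (λ j → r * lookup a j) (m * h) i ∎
      where open ≡-Reasoning

    -- The largest letter. Writing r as m s makes everything beyond λ₁ a multiple of m, so that the
    -- bound m k on letters can be divided by m; this is the source of the exponent s of t.
    decomposed-zero : ∀ a h → decomposed g a h zero ≡ lam g zero + m * (sumℕ (λ j → lookup a j * s) + h)
    decomposed-zero a h = begin
      decomposed g a h zero
        ≡⟨ decomposed-split a h zero ⟩
      lam g zero + staircase (λ j → r * lookup a j) (m * h) zero
        ≡⟨ cong (lam g zero +_) (staircase-zero (λ j → r * lookup a j) (m * h)) ⟩
      lam g zero + (sumℕ (λ j → r * lookup a j) + m * h)
        ≡⟨ cong (λ x → lam g zero + (x + m * h)) (sum-cong-≗ λ j →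
             trans (cong (_* lookup a j) (sym m*s≡r)) (trans (ℕ.*-assoc m s _) (cong (m *_) (ℕ.*-comm s _)))) ⟩
      lam g zero + (sumℕ (λ j → m * (lookup a j * s)) + m * h)
        ≡⟨ cong (λ x → lam g zero + (x + m * h)) (*-distribˡ-sum m (λ j → lookup a j * s)) ⟨
      lam g zero + (m * sumℕ (λ j → lookup a j * s) + m * h)
        ≡⟨ cong (lam g zero +_) (ℕ.*-distribˡ-+ m _ h) ⟨
      lam g zero + m * (sumℕ (λ j → lookup a j * s) + h) ∎
      where open ≡-Reasoning

    sum-decomposed : ∀ a h → sumℕ (decomposed g a h) ≡
                     fmaj g + (sumℕ (λ j → lookup a j * (suc (toℕ j) * r)) + h * (suc n * r / s))
    sum-decomposed a h = begin
      sumℕ (decomposed g a h)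
        ≡⟨ sum-cong-≗ (decomposed-split a h) ⟩
      sumℕ (λ i → lam g i + staircase (λ j → r * lookup a j) (m * h) i)
        ≡⟨ ∑-distrib-+ (lam g) (staircase (λ j → r * lookup a j) (m * h)) ⟩
      fmaj g + sumℕ (staircase (λ j → r * lookup a j) (m * h))
        ≡⟨ cong (fmaj g +_) (sum-staircase (λ j → r * lookup a j) (m * h)) ⟩
      fmaj g + (sumℕ (λ j → suc (toℕ j) * (r * lookup a j)) + suc n * (m * h))
        ≡⟨ cong (fmaj g +_) (cong₂ _+_
             (sum-cong-≗ λ j → rearrange (suc (toℕ j)) r (lookup a j))
             -- Since s divides r, the exponent `suc n * r / s` is `suc n * m`.
             (trans (rearrange (suc n) m h) (cong (h *_) (sym (*-/-assoc (suc n) s∣r))))) ⟩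
      fmaj g + (sumℕ (λ j → lookup a j * (suc (toℕ j) * r)) + h * (suc n * r / s)) ∎
      where
      open ≡-Reasoning
      rearrange : ∀ x y z → x * (y * z) ≡ z * (x * y)
      rearrange = solve-∀

  -- The bijection between codes and words

  module _ {p : ℕ} .{{_ : NonZero p}} (p∣r : p ∣ r) (ps∣rn : p * s ∣ r * suc n)
           (reps : List (DecSetoid.Carrier (G[r,p,s,n] r (suc n) s s∣r p)))
           (complete : IsEnumeration (DecSetoid.setoid (G[r,p,s,n] r (suc n) s s∣r p)) reps)
           (unique : Unique (DecSetoid.setoid (G[r,p,s,n] r (suc n) s s∣r p)) reps) where

    rep : Fin (length reps) → ColouredPermutation r (suc n)
    rep i = proj₁ (List.lookup reps i)

    ⟨des,fmaj⟩ : ColouredPermutation r (suc n) → ℕ × ℕ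
    ⟨des,fmaj⟩ g = des g , fmaj g

    Numerator : PowerSeries
    Numerator = foldr (λ (g , _) F → t^ des g q^ fmaj g ⊕ F) 0# reps

    enumerates-Numerator : Numerator enumerates ⟨des,fmaj⟩ ∘ rep
    enumerates-Numerator = subst (_enumerates ⟨des,fmaj⟩ ∘ rep) (sym (∑-lookup (⟨des,fmaj⟩ ∘ proj₁) reps))
      (enumerates-∑-monomials (⟨des,fmaj⟩ ∘ proj₁) (List.lookup reps))

    factor⁻¹ : Fin n → PowerSeries
    factor⁻¹ i = geometric s (suc (toℕ i) * r)

    Denominator⁻¹ : PowerSeries
    Denominator⁻¹ = geometric 1 0 ⊛ ∏ factor⁻¹ ⊛ geometric 1 (suc n * r / s)

    -- An element of G(r,p,s,n) with exponents in the expansions of 1 / (1 - t), of the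
    -- 1 / (1 - tˢqʲʳ), and of 1 / (1 - tq^(nr/s)).
    Codes : Set
    Codes = Fin (length reps) × ((ℕ × Vec ℕ n) × ℕ)

    codeWeight : Codes → ℕ × ℕ
    codeWeight (i , (c , a) , h) = ⟨des,fmaj⟩ (rep i) ⊹
      (multiples 1 0 c ⊹ ⟨∑⟩ (λ j → multiples s (suc (toℕ j) * r) (lookup a j)) ⊹ multiples 1 (suc n * r / s) h)

    enumerates-Codes : Numerator ⊛ Denominator⁻¹ enumerates codeWeight
    enumerates-Codes = enumerates-⊛ enumerates-Numerator (enumerates-⊛
      (enumerates-⊛ (enumerates-geometric 1 0) (enumerates-∏ λ i → enumerates-geometric s (suc (toℕ i) * r)))
      (enumerates-geometric 1 (suc n * r / s)))

    Words : Set
    Words = Σ[ k ∈ ℕ ] Vec (Fin (m * k + 1)) (suc n)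

    wordWeight : Words → ℕ × ℕ
    wordWeight (k , v) = (k , 0) ⊹ ⟨∑⟩ (λ i → 0 , toℕ (lookup v i))

    DivisibleWords : Set
    DivisibleWords = Σ[ v ∈ Words ] True (p ∣? proj₂ (wordWeight v))

    enumerates-DivisibleWords : ⟦ ∑t^ (λ k → [ m * k + 1 ]q ↑ suc n) ⟧q^ p
                                enumerates λ ((v , _) : DivisibleWords) → wordWeight v
    enumerates-DivisibleWords = enumerates-⟦⟧ p (enumerates-∑t^ λ k →
      subst (_enumerates λ (v : Vec (Fin (m * k + 1)) (suc n)) → ⟨∑⟩ (λ i → 0 , toℕ (lookup v i)))
        (sym (↑≡∏ [ m * k + 1 ]q (suc n)))
        (enumerates-∏ {n = suc n} λ _ → enumerates-∑-monomials (λ a → 0 , toℕ a) (λ a → a)))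

    -- Letters are compared in sorted order, where `decomposed` is explicit. The condition on `k`
    -- ties down the slack `c`, which the letters do not see.
    Encodes : Codes → DivisibleWords → Set
    Encodes y@(i , (c , a) , h) ((k , v) , _) =
      k ≡ proj₁ (codeWeight y) × (∀ j → toℕ (lookup v (perm (rep i) ⟨$⟩ʳ j)) ≡ decomposed (rep i) a h j)

    word-exists : ∀ y → ∃[ v ] Encodes y v
    word-exists y@(i , (c , a) , h) =
      ((k , v) , fromWitness (subst (p ∣_) (sum-cong-≗ (sym ∘ v≗f)) p∣f)) ,
      refl , (λ j → trans (v≗f _) (f∘σ≗ j))
      where
      g = rep i
      k = proj₁ (codeWeight y)
      f : Fin (suc n) → ℕ
      f j = decomposed g a h (perm g ⟨$⟩ˡ j)

      f∘σ≗ : ∀ j → f (perm g ⟨$⟩ʳ j) ≡ decomposed g a h j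
      f∘σ≗ j = cong (decomposed g a h) (Perm.inverseˡ (perm g))

      -- The largest letter is bounded through λ₁ ≤ m des(g); the slack `c` can only enlarge `k`.
      f≤m*k : ∀ j → f j ≤ m * k
      f≤m*k j = begin
        f j                                                       ≤⟨ staircase≤zero _ _ (perm g ⟨$⟩ˡ j) ⟩
        decomposed g a h zero                                     ≡⟨ decomposed-zero g a h ⟩
        lam g zero + m * (Σa + h)                                 ≤⟨ ℕ.+-monoˡ-≤ _ (lam₀≤m*des g) ⟩
        m * des g + m * (Σa + h)                                  ≡⟨ ℕ.*-distribˡ-+ m (des g) _ ⟨
        m * (des g + (Σa + h))                                    ≤⟨ ℕ.*-monoʳ-≤ m (ℕ.+-monoʳ-≤ (des g)
          (ℕ.+-mono-≤ (ℕ.m≤n+m Σa (c * 1)) (ℕ.≤-reflexive (sym (ℕ.*-identityʳ h))))) ⟩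
        m * k                                                     ∎
        where
        open ℕ.≤-Reasoning
        Σa = sumℕ (λ j → lookup a j * s)

      f<m*k+1 : ∀ j → f j < m * k + 1
      f<m*k+1 j = subst (f j <_) (ℕ.+-comm 1 (m * k)) (s≤s (f≤m*k j))

      v : Vec (Fin (m * k + 1)) (suc n)
      v = tabulate (λ j → fromℕ< (f<m*k+1 j))

      v≗f : ∀ j → toℕ (lookup v j) ≡ f j
      v≗f j = trans (cong toℕ (lookup∘tabulate (λ j → fromℕ< (f<m*k+1 j)) j)) (Fin.toℕ-fromℕ< (f<m*k+1 j))

      p∣f : p ∣ sumℕ f
      p∣f = compatible⇒∣ p∣r ps∣rn {g} {f} (proj₂ (List.lookup reps i)) (decomposed⇒compatible g f a h f∘σ≗)

    compatible-code-exists : ∀ i (v : DivisibleWords) → Compatible (rep i) (λ j → toℕ (lookup (proj₂ (proj₁ v)) j)) →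
                             ∃[ y ] Encodes y v
    compatible-code-exists i ((k , v) , _) i-compatible =
      let a , h , f∘σ≗ = compatible⇒decomposed (rep i) (λ j → toℕ (lookup v j)) i-compatible in
      -- The slack is what `k` leaves over. `T≤k` and `des≤k∸T` ensure that neither subtraction is
      -- truncated.
      (i , (k ∸ T a h ∸ des g , a) , h) , k≡ a h f∘σ≗ , f∘σ≗
      where
      g = rep i
      T : Vec ℕ n → ℕ → ℕ
      T a h = sumℕ (λ j → lookup a j * s) + h
      module _ a h (f∘σ≗ : ∀ j → toℕ (lookup v (perm g ⟨$⟩ʳ j)) ≡ decomposed g a h j) where
        lam+mT≤mk : lam g zero + m * T a h ≤ m * k
        lam+mT≤mk = begin
          lam g zero + m * T a h               ≡⟨ decomposed-zero g a h ⟨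
          decomposed g a h zero                ≡⟨ f∘σ≗ zero ⟨
          v₀                                   ≤⟨ ℕ.≤-pred (subst (v₀ <_) (ℕ.+-comm (m * k) 1) (Fin.toℕ<n _)) ⟩
          m * k                                ∎
          where
          open ℕ.≤-Reasoning
          v₀ = toℕ (lookup v (perm g ⟨$⟩ʳ zero))
        T≤k : T a h ≤ k
        T≤k = ℕ.*-cancelˡ-≤ m (ℕ.≤-trans (ℕ.m≤n+m (m * T a h) (lam g zero)) lam+mT≤mk)
        des≤k∸T : des g ≤ k ∸ T a h
        des≤k∸T = des≤ g (k ∸ T a h)
          (subst (lam g zero ≤_) (sym (ℕ.*-distribˡ-∸ m k (T a h))) (ℕ.m+n≤o⇒m≤o∸n (lam g zero) lam+mT≤mk))
        k≡ : k ≡ proj₁ (codeWeight (i , (k ∸ T a h ∸ des g , a) , h))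
        k≡ = begin
          k                                                       ≡⟨ ℕ.m∸n+n≡m T≤k ⟨
          k ∸ T a h + T a h                                       ≡⟨ cong (_+ T a h) (ℕ.m+[n∸m]≡n des≤k∸T) ⟨
          des g + (k ∸ T a h ∸ des g) + T a h                     ≡⟨ rearrange (des g) (k ∸ T a h ∸ des g) _ h ⟩
          proj₁ (codeWeight (i , (k ∸ T a h ∸ des g , a) , h))    ∎
          where
          open ≡-Reasoning
          rearrange : ∀ d c x h → d + c + (x + h) ≡ d + (c * 1 + x + h * 1)
          rearrange = solve-∀

    -- Sorting yields some element of the right coset; its compatibility with the word is carried
    -- over to the listed representative.
    code-exists : ∀ v → ∃[ y ] Encodes y v
    code-exists v@((_ , w) , p∣) =
      let g , g∈ , g-compatible = compatible-exists p∣r (λ j → toℕ (lookup w j)) (toWitness p∣)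
          g∈reps = complete (g , g∈)
      in compatible-code-exists (Any.index g∈reps) v
           (compatible-resp-∼ {g} {rep (Any.index g∈reps)} (lookup-index g∈reps) g-compatible)

    DivisibleWords-≡ : ∀ {k k′ v v′ p∣ p∣′} → k ≡ k′ → (∀ j → toℕ (lookup v j) ≡ toℕ (lookup v′ j)) →
                       _≡_ {A = DivisibleWords} ((k , v) , p∣) ((k′ , v′) , p∣′)
    DivisibleWords-≡ {k} {v = v} {v′} {p∣} {p∣′} refl v≗v′ = go (lookup-extensional (Fin.toℕ-injective ∘ v≗v′)) p∣ p∣′
      where
      go : v ≡ v′ → ∀ p∣ p∣′ → _≡_ {A = DivisibleWords} ((k , v) , p∣) ((k , v′) , p∣′)
      go refl p∣ p∣′ = cong ((k , v) ,_) (T-irrelevant p∣ p∣′)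

    Encodes-functional : ∀ {y v v′} → Encodes y v → Encodes y v′ → v ≡ v′
    Encodes-functional {i , _} {(k , v) , p∣} {(k′ , v′) , p∣′} (k≡ , v≡) (k≡′ , v≡′) =
      DivisibleWords-≡ (trans k≡ (sym k≡′))
        (λ j → subst (λ j → toℕ (lookup v j) ≡ toℕ (lookup v′ j))
          (Perm.inverseʳ (perm (rep i))) (trans (v≡ _) (sym (v≡′ _))))

    -- Both representatives are compatible with the same word, hence lie in one coset, and the list
    -- meets each coset only once.
    code-index-unique : ∀ {i i′ y y′ v} → Encodes (i , y) v → Encodes (i′ , y′) v → i ≡ i′
    code-index-unique {i} {i′} {(_ , a) , h} {(_ , a′) , h′} {(_ , v) , _} (_ , v≡) (_ , v≡′) =
      lookup-injective (DecSetoid.setoid (G[r,p,s,n] r (suc n) s s∣r p)) unique i i′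
        (compatible-unique {rep i} {rep i′}
          (decomposed⇒compatible (rep i) (λ j → toℕ (lookup v j)) a h v≡)
          (decomposed⇒compatible (rep i′) (λ j → toℕ (lookup v j)) a′ h′ v≡′))

    decomposed-injective : ∀ g {a a′ h h′} → decomposed g a h ≗ decomposed g a′ h′ → a ≡ a′ × h ≡ h′
    decomposed-injective g {a} {a′} {h} {h′} eq =
      let d≗ , e≡ = staircase-injective eq in
      lookup-extensional {u = a} {a′} (λ j → ℕ.*-cancelˡ-≡ _ _ r (ℕ.+-cancelˡ-≡ (lamStep g j) _ _ (d≗ j))) ,
      ℕ.*-cancelˡ-≡ h h′ m (ℕ.+-cancelˡ-≡ (lamLast g) _ _ e≡)

    slack-unique : ∀ {c c′} d x y → d + (c * 1 + x + y) ≡ d + (c′ * 1 + x + y) → c ≡ c′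
    slack-unique {c} {c′} d x y eq =
      ℕ.*-cancelʳ-≡ c c′ 1 (ℕ.+-cancelʳ-≡ x _ _ (ℕ.+-cancelʳ-≡ y _ _ (ℕ.+-cancelˡ-≡ d _ _ eq)))

    Encodes-injective : ∀ {y y′ v} → Encodes y v → Encodes y′ v → y ≡ y′
    Encodes-injective {i , (c , a) , h} {i′ , (c′ , a′) , h′} {v} enc enc′ =
      go (code-index-unique {y = (c , a) , h} {y′ = (c′ , a′) , h′} {v = v} enc enc′) enc enc′
      where
      go : i ≡ i′ → Encodes (i , (c , a) , h) v → Encodes (i′ , (c′ , a′) , h′) v →
           (i , (c , a) , h) ≡ (i′ , (c′ , a′) , h′)
      go refl (k≡ , v≡) (k≡′ , v≡′) = go′ (decomposed-injective (rep i) (λ j → trans (sym (v≡ j)) (v≡′ j)))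
        where
        go′ : a ≡ a′ × h ≡ h′ → (i , (c , a) , h) ≡ (i , (c′ , a′) , h′)
        go′ (refl , refl) = cong (λ c → i , (c , a) , h) (slack-unique (des (rep i)) _ (h * 1) (trans (sym k≡) k≡′))

    Encodes-weight : ∀ {y v} → Encodes y v → wordWeight (proj₁ v) ≡ codeWeight y
    Encodes-weight {i , (c , a) , h} {(k , v) , _} (k≡ , v≡) = cong₂ _,_
      (trans (cong (k +_) (sum-replicate-zero (suc n))) (trans (ℕ.+-identityʳ k) k≡))
      (begin
        sumℕ (λ j → toℕ (lookup v j))
          ≡⟨ sum-permute (λ j → toℕ (lookup v j)) (perm (rep i)) ⟩
        sumℕ (λ j → toℕ (lookup v (perm (rep i) ⟨$⟩ʳ j)))
          ≡⟨ sum-cong-≗ v≡ ⟩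
        sumℕ (decomposed (rep i) a h)
          ≡⟨ sum-decomposed (rep i) a h ⟩
        fmaj (rep i) + (sumℕ (λ j → lookup a j * (suc (toℕ j) * r)) + h * (suc n * r / s))
          ≡⟨ cong (λ x → fmaj (rep i) + (x + sumℕ (λ j → lookup a j * (suc (toℕ j) * r)) + h * (suc n * r / s))) (ℕ.*-zeroʳ c) ⟨
        proj₂ (codeWeight (i , (c , a) , h)) ∎)
      where open ≡-Reasoning

    words≋codes : ⟦ ∑t^ (λ k → [ m * k + 1 ]q ↑ suc n) ⟧q^ p
      ≋ Numerator ÷ ((1# ⊖ t^ 1 q^ 0) ⊛ ∏ {n} (λ i → 1# ⊖ t^ s q^ (suc (toℕ i) * r))
                      ⊛ (1# ⊖ t^ 1 q^ (suc n * r / s)))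
    words≋codes =
      Denominator⁻¹ ,
      ⊛-inverse {(1# ⊖ t^ 1 q^ 0) ⊛ ∏ factor} {geometric 1 0 ⊛ ∏ factor⁻¹}
        {1# ⊖ t^ 1 q^ (suc n * r / s)} {geometric 1 (suc n * r / s)}
        (⊛-inverse {1# ⊖ t^ 1 q^ 0} {geometric 1 0} {∏ factor} {∏ factor⁻¹} (1⊖-inverse 1 0)
          (∏-inverse factor factor⁻¹ (λ i → 1⊖-inverse s (suc (toℕ i) * r))))
        (1⊖-inverse 1 (suc n * r / s)) ,
      enumerates-unique enumerates-DivisibleWords enumerates-Codes (λ i j → ↔-sym
        (Fibre-↔-relation Encodes word-exists code-exists
          (λ {y} {v} {v′} → Encodes-functional {y} {v} {v′}) (λ {y} {y′} {v} → Encodes-injective {y} {y′} {v})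
          (λ {y} {v} → Encodes-weight {y} {v}) i j))
      where
      factor : Fin n → PowerSeries
      factor i = 1# ⊖ t^ s q^ (suc (toℕ i) * r)

corollary5p3 : (r p s n : ℕ) .{{_ : NonZero r}} .{{_ : NonZero p}} .{{_ : NonZero s}} .{{_ : NonZero n}} →
    p ∣ r → (s∣r : s ∣ r) → p * s ∣ r * n →
    let open Statistics {r} {n} s s∣r in
    ⟦ ∑t^ (λ k → [ r / s * k + 1 ]q ↑ n) ⟧q^ p
    ≋ ∑G[r,p,s,n] r n s s∣r p (λ g → t^ des g q^ fmaj g)
    ÷ ((1# ⊖ t^ 1 q^ 0)
    ⊛ ∏ {n ∸ 1} (λ i → 1# ⊖ t^ s q^ (suc (toℕ i) * r))
    ⊛ (1# ⊖ t^ 1 q^ (n * r / s)))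
corollary5p3 r p s zero    p∣r s∣r ps∣rn = contradiction (>-nonZero⁻¹ 0) λ ()
corollary5p3 r p s (suc n) p∣r s∣r ps∣rn = words≋codes p∣r ps∣rn
  (representatives r (suc n) s s∣r p)
  (representatives-complete r (suc n) s s∣r p)
  (representatives-unique r (suc n) s s∣r p)
  where open Decomposition r s n s∣r
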